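{- Let $n,k$ be integers with $1\le k\le \lfloor n/2\rfloor$, and let $\mathcal{O}(n,k)$ be the set of trees of order $n$ having exactly $2k$ odd vertices. If $T\in\mathcal{O}(n,k)$ has maximum Mostar index among all trees in $\mathcal{O}(n,k)$, then $T\cong S_{n,2k}$, where in the case $k=n/2$ we set $S_{n,n}=S_n$.
   Context: For a connected simple graph $G$, the Mostar index is $Mo(G)=\sum_{uv\in E(G)}|n_u-n_v|$, where for an edge $e=uv$, $n_u$ is the number of vertices of $G$ closer (in graph distance) to $u$ than to $v$, and $n_v$ is the number of vertices closer to $v$ than to $u$. The order of a graph is its number of vertices. A vertex is odd if its degree is odd. $S_n$ and $P_n$ denote the star and the path on $n$ vertices. For $3\le r\le n-2$, $S_{n,r}$ is the $n$-vertex tree consisting of $r$ pendent paths attached at a common vertex (i.e. a spider with $r$ legs), of which $t$ have length $\lfloor\frac{n-1}{r}\rfloor+1$ and $r-t$ have length $\lfloor\frac{n-1}{r}\rfloor$, where $t=n-1-r\lfloor\frac{n-1}{r}\rfloor$ (length = number of edges). Also $S_{n,n-1}=S_n$ and $S_{n,2}=P_n$. -}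

module Defs where

open import Algebra.Properties.CommutativeMonoid.Sum using (sum)
open import Data.Bool.Base using (if_then_else_)
open import Data.Empty using (⊥)
open import Data.Fin.Base as Fin using (Fin; toℕ; inject₁; fromℕ)
open import Data.Fin.Properties as Fin using (any?)
open import Data.Nat.Base
open import Data.Nat.DivMod using (_/_; _%_)
open import Data.Nat.Properties using (_≟_; _<?_; 1+n≢n; +-0-commutativeMonoid)
open import Data.Product using (Σ; ∃-syntax; _×_; _,_)
open import Data.Sum using (_⊎_; inj₁; inj₂; swap)
open import Function.Base using (_∘_)
open import Function.Bundles using (_⤖_; _⇔_; Bijection)
open import Function.Definitions using (Injective)
open import Level using (0ℓ)
open import Relation.Binary.Core using (Rel)
import Relation.Binary.Definitions as B
open import Relation.Binary.PropositionalEquality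
  using (_≡_; refl; sym)
open import Relation.Nullary
  using (¬_; Dec; no; does; ¬?; _×-dec_; _⊎-dec_)
open import Relation.Nullary.Decidable using (map′)
open import Relation.Unary using (Pred; Decidable)

------------------------------------------------------------------------
-- Simple graphs

record Graph (V : Set) : Set₁ where
  infix 4 _~_ _~?_
  field
    _~_      : Rel V 0ℓ
    _~?_     : B.Decidable _~_
    ~-sym    : B.Symmetric _~_
    ~-irrefl : ∀ {v} → ¬ (v ~ v)

infix 4 _≅_

record _≅_ {V W : Set} (G : Graph V) (H : Graph W) : Set where
  private
    module G = Graph G
    module H = Graph H
  field
    bijection : V ⤖ W
  open Bijection bijection using (to)
  field
    adjacency : ∀ u v → (u G.~ v) ⇔ (to u H.~ to v)

data Walk {V : Set} (G : Graph V) : ℕ → V → V → Set where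
  []  : ∀ {u} → Walk G 0 u u
  _∷_ : ∀ {m u v w} → Graph._~_ G u v → Walk G m v w → Walk G (suc m) u w

Connected : {V : Set} → Graph V → Set
Connected G = ∀ u v → ∃[ m ] Walk G m u v

-- A cycle c₀ c₁ … c₍ₘ₊₂₎ c₀ through m + 3 distinct vertices.
record Cycle {V : Set} (G : Graph V) : Set where
  open Graph G
  field
    m        : ℕ
    c        : Fin (3 + m) → V
    distinct : Injective _≡_ _≡_ c
    steps    : ∀ (i : Fin (2 + m)) → c (inject₁ i) ~ c (Fin.suc i)
    closing  : c (fromℕ (2 + m)) ~ c Fin.zero

IsTree : {V : Set} → Graph V → Set
IsTree G = Connected G × ¬ Cycle G

------------------------------------------------------------------------
-- Finite sums and counting

∑ : ∀ {n} → (Fin n → ℕ) → ℕ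
∑ = sum +-0-commutativeMonoid

count : ∀ {n} {P : Pred (Fin n) 0ℓ} → Decidable P → ℕ
count P? = ∑ (λ i → if does (P? i) then 1 else 0)

-- The least d < b satisfying P, or b if there is none.
least : ∀ {P : Pred ℕ 0ℓ} (b : ℕ) → Decidable P → ℕ
least zero    P? = 0
least (suc b) P? = if does (P? 0) then 0 else suc (least b (P? ∘ suc))

------------------------------------------------------------------------
-- Graphs of order n, with vertex set Fin n

module _ {n : ℕ} (G : Graph (Fin n)) where
  open Graph G

  walk? : ∀ m u v → Dec (Walk G m u v)
  walk? zero    u v = map′ (λ { refl → [] }) (λ { [] → refl }) (u Fin.≟ v)
  walk? (suc m) u w = map′ (λ { (_ , e , p) → e ∷ p }) (λ { (e ∷ p) → _ , e , p })
                           (any? (λ v → (u ~? v) ×-dec walk? m v w))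

  -- The length of a shortest walk.  In a connected graph of order n there is
  -- always one of length < n; vertices in different components get the value n.
  dist : Fin n → Fin n → ℕ
  dist u v = least n (λ m → walk? m u v)

  -- The number of vertices closer to u than to v.
  closer : Fin n → Fin n → ℕ
  closer u v = count (λ w → dist w u <? dist w v)

  -- Each edge is summed once, with its endpoints ordered u < v.
  Mo : ℕ
  Mo = ∑ λ u → ∑ λ v →
         if does ((u Fin.<? v) ×-dec (u ~? v))
         then ∣ closer u v - closer v u ∣
         else 0

  degree : Fin n → ℕ
  degree u = count (u ~?_)

  OddVertex : Fin n → Set
  OddVertex u = degree u % 2 ≡ 1

  oddVertex? : Decidable OddVertex
  oddVertex? u = degree u % 2 ≟ 1

  #odd : ℕ
  #odd = count oddVertex?

-- T ∈𝒪 k for T of order n means T ∈ 𝒪(n,k).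
infix 4 _∈𝒪_

_∈𝒪_ : ∀ {n} → Graph (Fin n) → ℕ → Set
T ∈𝒪 k = IsTree T × #odd T ≡ 2 * k

------------------------------------------------------------------------
-- Stars, paths and spiders

-- The centre is the vertex numbered 0.
star : (n : ℕ) → Graph (Fin n)
star n = record
  { _~_      = λ u v → (toℕ u ≡ 0 × ¬ (toℕ v ≡ 0)) ⊎ (toℕ v ≡ 0 × ¬ (toℕ u ≡ 0))
  ; _~?_     = λ u v → ((toℕ u ≟ 0) ×-dec ¬? (toℕ v ≟ 0))
                       ⊎-dec ((toℕ v ≟ 0) ×-dec ¬? (toℕ u ≟ 0))
  ; ~-sym    = swap
  ; ~-irrefl = λ { (inj₁ (p , q)) → q p ; (inj₂ (p , q)) → q p }
  }

path : (n : ℕ) → Graph (Fin n)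
path n = record
  { _~_      = λ u v → suc (toℕ u) ≡ toℕ v ⊎ suc (toℕ v) ≡ toℕ u
  ; _~?_     = λ u v → (suc (toℕ u) ≟ toℕ v) ⊎-dec (suc (toℕ v) ≟ toℕ u)
  ; ~-sym    = swap
  ; ~-irrefl = λ { (inj₁ p) → 1+n≢n p ; (inj₂ p) → 1+n≢n p }
  }

-- A centre with r pendent paths attached, the i-th having ℓ i edges, hence
-- ℓ i vertices besides the centre.  In  leg i j  the vertex is at distance
-- j + 1 from the centre.
data SpiderVertex {r : ℕ} (ℓ : Fin r → ℕ) : Set where
  centre : SpiderVertex ℓ
  leg    : (i : Fin r) → Fin (ℓ i) → SpiderVertex ℓ

spider : ∀ {r} (ℓ : Fin r → ℕ) → Graph (SpiderVertex ℓ)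
spider {r} ℓ = record
  { _~_ = adj ; _~?_ = adj? ; ~-sym = λ {u} {v} → adj-sym u v
  ; ~-irrefl = λ {v} → adj-irrefl v }
  where
  adj : Rel (SpiderVertex ℓ) 0ℓ
  adj centre    centre      = ⊥
  adj centre    (leg _ j)   = toℕ j ≡ 0
  adj (leg _ j) centre      = toℕ j ≡ 0
  adj (leg i j) (leg i′ j′) =
    i ≡ i′ × (suc (toℕ j) ≡ toℕ j′ ⊎ suc (toℕ j′) ≡ toℕ j)

  adj? : B.Decidable adj
  adj? centre    centre      = no λ ()
  adj? centre    (leg _ j)   = toℕ j ≟ 0
  adj? (leg _ j) centre      = toℕ j ≟ 0
  adj? (leg i j) (leg i′ j′) =
    (i Fin.≟ i′) ×-dec ((suc (toℕ j) ≟ toℕ j′) ⊎-dec (suc (toℕ j′) ≟ toℕ j))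

  adj-sym : ∀ u v → adj u v → adj v u
  adj-sym centre    (leg _ _) p       = p
  adj-sym (leg _ _) centre    p       = p
  adj-sym (leg _ _) (leg _ _) (e , p) = sym e , swap p

  adj-irrefl : ∀ v → ¬ adj v v
  adj-irrefl (leg _ _) (_ , inj₁ p) = 1+n≢n p
  adj-irrefl (leg _ _) (_ , inj₂ p) = 1+n≢n p

-- With q = ⌊(n-1)/r⌋ and t = n-1-rq, the first t legs have length q + 1 and
-- the remaining r - t have length q.
balanced : (n r : ℕ) → .{{_ : NonZero r}} → Fin r → ℕ
balanced n r i = if does (toℕ i <? t) then q + 1 else q
  where
  q = (n ∸ 1) / r
  t = (n ∸ 1) ∸ r * q

-- S n r is paired with its vertex type, which differs between the cases.
-- Only 2 ≤ r ≤ n is meaningful; the values for r = 0, 1 and r > n are junk.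
S : (n r : ℕ) → Σ Set Graph
S n 2 = _ , path n
S n r@(suc (suc (suc _))) =
  if does ((r ≟ n) ⊎-dec (r ≟ n ∸ 1))
  then (_ , star n)
  else (_ , spider (balanced n r))
S n _ = _ , path n

module Submission where

-- Root a tree T at a vertex c and let s(v) be the number of vertices in the
-- branch hanging at v.  The edge from v to its parent contributes
-- |n − 2 s(v)| ≥ n − 2 s(v) to the Mostar index, and the s(v) add up to the
-- total depth, so Mo(T) ≥ n (n − 1) − 2 ∑ depth, with equality if c minimises
-- the total distance.  A non-root vertex without children is odd, hence there
-- are at most r = 2k of them, and so every level below the root has at most r
-- vertices; therefore at least n − 1 − r i vertices have depth > i.  All these
-- bounds are attained by S_{n,r}, so a maximal T, rooted at its median, attains
-- them too.  Then no vertex but the root has two children, i.e. T is a spider,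
-- and the sizes of the levels determine its legs.  For k = 1 maximality is not
-- needed: rooted at an odd vertex, T has a single leaf, so it is a path.

open import Algebra.Properties.CommutativeMonoid.Sum using (∑-comm; ∑-distrib-+; sum-cong-≗)
open import Algebra.Properties.Semiring.Sum using (*-distribˡ-sum)
open import Data.Bool.Base using (if_then_else_; true; false)
open import Data.Empty using (⊥)
open import Data.Fin.Base as Fin using (Fin; zero; suc; toℕ; fromℕ; fromℕ<; inject₁; punchOut)
open import Data.Fin.Properties as Fin using (any?; toℕ-injective; toℕ-fromℕ<; toℕ<n)
open import Data.Fin.Relation.Unary.Top using (view; ‵fromℕ; ‵inject₁)
open import Data.List.Base using (List; []; _∷_; length; lookup)
open import Data.List.Membership.DecPropositional using (_∈?_)
open import Data.List.Membership.Propositional using (_∈_)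
open import Data.List.Membership.Propositional.Properties using (∈-lookup)
open import Data.List.Relation.Unary.All as All using (All; []; _∷_)
open import Data.List.Relation.Unary.All.Properties using (¬Any⇒All¬)
open import Data.List.Relation.Unary.Any using (here; there)
open import Data.Nat.Base
open import Data.Nat.DivMod
open import Data.Nat.Properties
open import Data.Nat.Tactic.RingSolver using (solve-∀)
open import Data.Product using (Σ; ∃; ∃-syntax; _×_; _,_; proj₁; proj₂)
open import Data.Sum as Sum using (_⊎_; inj₁; inj₂; [_,_]′; swap)
open import Data.Unit.Base using (⊤; tt)
open import Function.Base using (_∘_; id)
open import Function.Bundles using (_⤖_; mk⤖; _⇔_; mk⇔)
import Function.Construct.Composition as Composition
import Function.Construct.Identity as Identity
open import Function.Definitions using (Injective; Surjective)
open import Level using (0ℓ)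
open import Relation.Binary.Definitions using (tri<; tri≈; tri>)
open import Relation.Binary.PropositionalEquality
open import Relation.Nullary using (¬_; Dec; yes; no; does; ¬?; _×-dec_; _⊎-dec_; contradiction)
open import Relation.Nullary.Decidable using (map′; dec-true; dec-false)
open import Relation.Unary using (Pred; Decidable)
open import Defs

-- `Mo` is defined only for graphs on `Fin n`, whereas the spider in `S` lives on `SpiderVertex`.
-- Star and spider are therefore both represented by one graph on `Fin n`, `Numbered.graph`, in
-- which truncated subtraction of `r` moves one step towards the centre: for v other than 0,
-- dividing v - 1 by `r` gives the leg as remainder and the depth, less one, as quotient. This graph
-- is the competitor to which maximality is applied and also the target of the isomorphism built
-- from T. Its Mostar index is never evaluated, since a lower bound for it and an upper bound for T
-- are enough.
--
-- The remaining obstacle is that level sizes do not single out a bijection. It comes from sorting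
-- the branches of T by height: the rank of a branch becomes the remainder, the depth of a vertex
-- the quotient.

-- Indicators, finite sums and counting.

⟦_⟧ : {P : Set} → Dec P → ℕ
⟦ P? ⟧ = if does P? then 1 else 0

module _ {P : Set} (P? : Dec P) where

  ⟦⟧-true : P → ⟦ P? ⟧ ≡ 1
  ⟦⟧-true p rewrite dec-true P? p = refl

  ⟦⟧-false : ¬ P → ⟦ P? ⟧ ≡ 0
  ⟦⟧-false ¬p rewrite dec-false P? ¬p = refl

  ⟦⟧≤1 : ⟦ P? ⟧ ≤ 1
  ⟦⟧≤1 with does P?
  ... | true  = ≤-refl
  ... | false = z≤n

⟦⟧-mono : {P Q : Set} (P? : Dec P) (Q? : Dec Q) → (P → Q) → ⟦ P? ⟧ ≤ ⟦ Q? ⟧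
⟦⟧-mono (yes p) Q? f = ≤-reflexive (sym (⟦⟧-true Q? (f p)))
⟦⟧-mono (no _)  Q? f = z≤n

⟦⟧-cong : {P Q : Set} (P? : Dec P) (Q? : Dec Q) → (P → Q) → (Q → P) → ⟦ P? ⟧ ≡ ⟦ Q? ⟧
⟦⟧-cong P? Q? f g = ≤-antisym (⟦⟧-mono P? Q? f) (⟦⟧-mono Q? P? g)

⟦⟧-× : {P Q : Set} (P? : Dec P) (Q? : Dec Q) → ⟦ P? ×-dec Q? ⟧ ≡ ⟦ P? ⟧ * ⟦ Q? ⟧
⟦⟧-× (yes _) Q? = sym (+-identityʳ ⟦ Q? ⟧)
⟦⟧-× (no _)  Q? = refl

if-× : {P Q : Set} (P? : Dec P) (Q? : Dec Q) {a : ℕ} →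
  (if does (P? ×-dec Q?) then a else 0) ≡ ⟦ P? ⟧ * (⟦ Q? ⟧ * a)
if-× P? Q? with does P? | does Q?
... | false | _     = refl
... | true  | false = refl
... | true  | true  = sym (trans (*-identityˡ _) (*-identityˡ _))

∑-cong : ∀ {n} {f g : Fin n → ℕ} → (∀ i → f i ≡ g i) → ∑ f ≡ ∑ g
∑-cong = sum-cong-≗ +-0-commutativeMonoid

∑-+ : ∀ {n} (f g : Fin n → ℕ) → ∑ (λ i → f i + g i) ≡ ∑ f + ∑ g
∑-+ = ∑-distrib-+ +-0-commutativeMonoid

∑-swap : ∀ {m n} (f : Fin m → Fin n → ℕ) → ∑ (λ i → ∑ (f i)) ≡ ∑ (λ j → ∑ (λ i → f i j))
∑-swap = ∑-comm +-0-commutativeMonoid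

∑-*ˡ : ∀ {n} k (f : Fin n → ℕ) → ∑ (λ i → k * f i) ≡ k * ∑ f
∑-*ˡ k f = sym (*-distribˡ-sum +-*-semiring k f)

∑-mono : ∀ {n} {f g : Fin n → ℕ} → (∀ i → f i ≤ g i) → ∑ f ≤ ∑ g
∑-mono {zero}  f≤g = z≤n
∑-mono {suc n} f≤g = +-mono-≤ (f≤g zero) (∑-mono (f≤g ∘ suc))

∑-const : ∀ n k → ∑ {n} (λ _ → k) ≡ n * k
∑-const zero    k = refl
∑-const (suc n) k = cong (k +_) (∑-const n k)

-- Each term of `f` can only fall short, so once the totals agree none does. This is how extremality
-- of a sum reaches single levels (`Maximal.deep≡`) and single vertices (`unique-child`).
∑-squeeze : ∀ {n} {f g : Fin n → ℕ} → (∀ i → f i ≤ g i) → ∑ g ≤ ∑ f → ∀ i → f i ≡ g i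
∑-squeeze {suc n} {f} {g} f≤g ∑g≤∑f zero = ≤-antisym (f≤g zero)
  (+-cancelʳ-≤ (∑ (g ∘ suc)) _ _ (≤-trans ∑g≤∑f (+-monoʳ-≤ (f zero) (∑-mono (f≤g ∘ suc)))))
∑-squeeze {suc n} {f} {g} f≤g ∑g≤∑f (suc i) = ∑-squeeze (f≤g ∘ suc)
  (+-cancelˡ-≤ (g zero) _ _ (≤-trans ∑g≤∑f (+-monoˡ-≤ (∑ (f ∘ suc)) (f≤g zero)))) i

∑-pick : ∀ {n} (x : Fin n) (f : Fin n → ℕ) → ∑ (λ i → ⟦ x Fin.≟ i ⟧ * f i) ≡ f x
∑-pick {suc n} zero f = begin
  1 * f zero + ∑ {n} (λ _ → 0)  ≡⟨ cong₂ _+_ (*-identityˡ _) (trans (∑-const n 0) (*-zeroʳ n)) ⟩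
  f zero + 0                    ≡⟨ +-identityʳ _ ⟩
  f zero                        ∎
  where open ≡-Reasoning
∑-pick (suc x) f = trans (∑-cong λ i → cong (_* f (suc i))
  (⟦⟧-cong (suc x Fin.≟ suc i) (x Fin.≟ i) Fin.suc-injective (cong suc))) (∑-pick x (f ∘ suc))

count-singleton : ∀ {n} (x : Fin n) → count (x Fin.≟_) ≡ 1
count-singleton {n} x = trans (∑-cong {n} λ i → sym (*-identityʳ _)) (∑-pick x (λ _ → 1))

module _ {n} {P Q : Pred (Fin n) 0ℓ} (P? : Decidable P) (Q? : Decidable Q) where

  count-mono : (∀ {i} → P i → Q i) → count P? ≤ count Q?
  count-mono P⊆Q = ∑-mono λ i → ⟦⟧-mono (P? i) (Q? i) P⊆Q

  count-cong : (∀ {i} → P i → Q i) → (∀ {i} → Q i → P i) → count P? ≡ count Q?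
  count-cong P⊆Q Q⊆P = ≤-antisym (count-mono P⊆Q) (∑-mono λ i → ⟦⟧-mono (Q? i) (P? i) Q⊆P)

  count-strict : (∀ {i} → P i → Q i) → ∀ i → Q i → ¬ P i → count P? < count Q?
  count-strict P⊆Q i q ¬p = begin-strict
    count P?                                     <⟨ ≤-refl ⟩
    1 + count P?                                 ≡⟨ cong (_+ count P?) (count-singleton i) ⟨
    count (i Fin.≟_) + count P?                  ≡⟨ ∑-+ (λ j → ⟦ i Fin.≟ j ⟧) (λ j → ⟦ P? j ⟧) ⟨
    ∑ (λ j → ⟦ i Fin.≟ j ⟧ + ⟦ P? j ⟧)           ≤⟨ ∑-mono pointwise ⟩
    count Q?                                     ∎
    where
    open ≤-Reasoning
    pointwise : ∀ j → ⟦ i Fin.≟ j ⟧ + ⟦ P? j ⟧ ≤ ⟦ Q? j ⟧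
    pointwise j with i Fin.≟ j
    ... | yes refl = ≤-reflexive (trans (cong suc (⟦⟧-false (P? j) ¬p)) (sym (⟦⟧-true (Q? j) q)))
    ... | no _     = ⟦⟧-mono (P? j) (Q? j) P⊆Q

  -- Double count the pairs `(j , f j)` with `Q j`: each `j` has a single image, and each `i` in `P`
  -- is hit at least once.
  count-cover : (f : Fin n → Fin n) → (∀ i → P i → ∃[ j ] Q j × f j ≡ i) → count P? ≤ count Q?
  count-cover f onto = begin
    count P?                                          ≤⟨ ∑-mono pointwise ⟩
    ∑ (λ i → ∑ (λ j → ⟦ Q? j ⟧ * ⟦ f j Fin.≟ i ⟧))    ≡⟨ ∑-swap (λ i j → ⟦ Q? j ⟧ * ⟦ f j Fin.≟ i ⟧) ⟩
    ∑ (λ j → ∑ (λ i → ⟦ Q? j ⟧ * ⟦ f j Fin.≟ i ⟧))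
      ≡⟨ ∑-cong (λ j → ∑-*ˡ ⟦ Q? j ⟧ (λ i → ⟦ f j Fin.≟ i ⟧)) ⟩
    ∑ (λ j → ⟦ Q? j ⟧ * count (f j Fin.≟_))
      ≡⟨ ∑-cong (λ j → cong (⟦ Q? j ⟧ *_) (count-singleton (f j))) ⟩
    ∑ (λ j → ⟦ Q? j ⟧ * 1)                            ≡⟨ ∑-cong (λ j → *-identityʳ ⟦ Q? j ⟧) ⟩
    count Q?                                          ∎
    where
    open ≤-Reasoning
    pointwise : ∀ i → ⟦ P? i ⟧ ≤ ∑ (λ j → ⟦ Q? j ⟧ * ⟦ f j Fin.≟ i ⟧)
    pointwise i with P? i
    ... | no _  = z≤n
    ... | yes p with onto i p
    ...   | j , q , refl = begin
      1                                                       ≡⟨ count-singleton j ⟨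
      ∑ (λ j′ → ⟦ j Fin.≟ j′ ⟧)                               ≤⟨ ∑-mono below ⟩
      ∑ (λ j′ → ⟦ Q? j′ ⟧ * ⟦ f j′ Fin.≟ f j ⟧)               ∎
      where
      below : ∀ j′ → ⟦ j Fin.≟ j′ ⟧ ≤ ⟦ Q? j′ ⟧ * ⟦ f j′ Fin.≟ f j ⟧
      below j′ with j Fin.≟ j′
      ... | no _     = z≤n
      ... | yes refl = ≤-reflexive (sym (cong₂ _*_ (⟦⟧-true (Q? j) q) (⟦⟧-true (f j Fin.≟ f j) refl)))

count-unique : ∀ {n} {P : Pred (Fin n) 0ℓ} (P? : Decidable P) → count P? ≤ 1 → ∀ {i j} → P i → P j →
  i ≡ j
count-unique P? ≤1 {i} {j} p q with i Fin.≟ j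
... | yes i≡j = i≡j
... | no i≢j  = contradiction
  (≤-trans (≤-trans (≤-reflexive (cong suc (sym (count-singleton i))))
    (count-strict (i Fin.≟_) P? (λ { refl → p }) j q i≢j)) ≤1)
  (<⇒≱ ≤-refl)

count≤n : ∀ {n} {P : Pred (Fin n) 0ℓ} (P? : Decidable P) → count P? ≤ n
count≤n {n} P? = ≤-trans (∑-mono (⟦⟧≤1 ∘ P?)) (≤-reflexive (trans (∑-const n 1) (*-identityʳ n)))

count-witness : ∀ {n} {P : Pred (Fin n) 0ℓ} (P? : Decidable P) → 0 < count P? → ∃ P
count-witness {n} P? 0<c with any? P?
... | yes w = w
... | no ¬w = contradiction
  (trans (∑-cong λ i → ⟦⟧-false (P? i) (λ p → ¬w (i , p))) (trans (∑-const n 0) (*-zeroʳ n)))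
  (>⇒≢ 0<c)

count-∁ : ∀ {n} {P : Pred (Fin n) 0ℓ} (P? : Decidable P) → count P? + count (¬? ∘ P?) ≡ n
count-∁ {n} P? = trans (sym (∑-+ (λ i → ⟦ P? i ⟧) _))
  (trans (∑-cong pointwise) (trans (∑-const n 1) (*-identityʳ n)))
  where
  pointwise : ∀ i → ⟦ P? i ⟧ + ⟦ ¬? (P? i) ⟧ ≡ 1
  pointwise i with does (P? i)
  ... | true  = refl
  ... | false = refl

count-≥ : ∀ n a → count {n} (λ i → a ≤? toℕ i) ≡ n ∸ a
count-≥ zero    zero    = refl
count-≥ zero    (suc a) = refl
count-≥ (suc n) zero    = cong suc (trans (∑-cong {n} λ i → refl) (count-≥ n 0))
count-≥ (suc n) (suc a) = trans
  (∑-cong {n} λ i → ⟦⟧-cong (suc a ≤? suc (toℕ i)) (a ≤? toℕ i) s≤s⁻¹ s≤s) (count-≥ n a)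

count-< : ∀ {n} a → a ≤ n → count {n} (λ i → toℕ i <? a) ≡ a
count-< {n} a a≤n = +-cancelʳ-≡ (n ∸ a) _ _ (begin
  count <a? + (n ∸ a)            ≡⟨ cong (count <a? +_) (count-≥ n a) ⟨
  count <a? + count ≥a?          ≡⟨ cong (count <a? +_) (count-cong ≥a? (¬? ∘ <a?) ≤⇒≯ ≮⇒≥) ⟩
  count <a? + count (¬? ∘ <a?)   ≡⟨ count-∁ <a? ⟩
  n                              ≡⟨ m+[n∸m]≡n a≤n ⟨
  a + (n ∸ a)                    ∎)
  where
  open ≡-Reasoning
  <a? = λ (i : Fin n) → toℕ i <? a
  ≥a? = λ (i : Fin n) → a ≤? toℕ i

-- Extremal elements, pigeonhole and least numbers.

-- An arbitrary total preorder as `R` gives minima and maxima alike: a median, and the deepest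
-- vertices of cycles and branches.
extremal : ∀ {n} (R : Fin (suc n) → Fin (suc n) → Set) →
  (∀ {i j k} → R i j → R j k → R i k) → (∀ i j → R i j ⊎ R j i) → ∃[ i ] ∀ j → R i j
extremal {zero}  R tr tot = zero , λ { zero → [ id , id ]′ (tot zero zero) }
extremal {suc n} R tr tot with extremal (λ i j → R (suc i) (suc j)) tr (λ i j → tot (suc i) (suc j))
... | i , best with tot zero (suc i)
...   | inj₁ r = zero  , λ { zero → [ id , id ]′ (tot zero zero) ; (suc j) → tr r (best j) }
...   | inj₂ r = suc i , λ { zero → r ; (suc j) → best j }

injective⇒surjective : ∀ {n} {f : Fin n → Fin n} → Injective _≡_ _≡_ f → Surjective _≡_ _≡_ f
injective⇒surjective {suc n} {f} inj y with any? (λ x → f x Fin.≟ y)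
... | yes (x , fx≡y) = x , λ { refl → fx≡y }
-- Removing a missed value `y` from the codomain would inject `Fin (suc n)` into `Fin n`.
... | no ∄x = contradiction
  (Fin.injective⇒≤ {f = λ x → punchOut (y≢f x)} λ {x} {x′} → inj ∘ Fin.punchOut-injective (y≢f x)
    (y≢f x′))
  1+n≰n
  where
  y≢f : ∀ x → y ≢ f x
  y≢f x y≡fx = ∄x (x , sym y≡fx)

injective⇒⤖ : ∀ {n} {f : Fin n → Fin n} → Injective _≡_ _≡_ f → Fin n ⤖ Fin n
injective⇒⤖ inj = mk⤖ (inj , injective⇒surjective inj)

least-≤ : ∀ {P : Pred ℕ 0ℓ} b (P? : Decidable P) {m} → P m → least b P? ≤ m
least-≤ zero    P? p = z≤n
least-≤ (suc b) P? {m} p with P? 0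
... | yes _ = z≤n
least-≤ (suc b) P? {zero}  p | no ¬p = contradiction p ¬p
least-≤ (suc b) P? {suc m} p | no _  = s≤s (least-≤ b (P? ∘ suc) p)

least-satisfies : ∀ {P : Pred ℕ 0ℓ} b (P? : Decidable P) → least b P? < b → P (least b P?)
least-satisfies (suc b) P? l<b with P? 0
... | yes p = p
... | no _  = least-satisfies b (P? ∘ suc) (s≤s⁻¹ l<b)

-- Walks, paths, cycles and distances.

walk-++ : ∀ {V} {G : Graph V} {l m u v w} → Walk G l u v → Walk G m v w → Walk G (l + m) u w
walk-++ []      q = q
walk-++ (e ∷ p) q = e ∷ walk-++ p q

walk-reverse : ∀ {V} {G : Graph V} {m u v} → Walk G m u v → ∃[ k ] Walk G k v u
walk-reverse []              = _ , []
walk-reverse {G = G} (e ∷ p) = _ , walk-++ (proj₂ (walk-reverse p)) (Graph.~-sym G e ∷ [])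

module Paths {n : ℕ} (G : Graph (Fin n)) where
  open Graph G

  private variable
    u v w x : Fin n
    ys : List (Fin n)
    P : Fin n → Set

  -- The vertices of the path are u ∷ ys.
  data Path : Fin n → List (Fin n) → Fin n → Set where
    []   : Path v [] v
    step : u ~ w → All (u ≢_) (w ∷ ys) → Path w ys v → Path u (w ∷ ys) v

  -- Forgets lengths and allows repetitions, so that connections with a constraint on their vertices
  -- can be joined and reversed freely; `within⇒path` makes them simple afterwards.
  data Within (P : Fin n → Set) : Fin n → Fin n → Set where
    [_] : P v → Within P v v
    _∷_ : P u × u ~ w → Within P w v → Within P u v

  within-++ : Within P u v → Within P v w → Within P u w
  within-++ [ _ ]   q = q
  within-++ (e ∷ p) q = e ∷ within-++ p q

  within-head : Within P u v → P u
  within-head [ p ]         = p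
  within-head ((p , _) ∷ _) = p

  within-reverse : Within P u v → Within P v u
  within-reverse [ p ]         = [ p ]
  within-reverse ((p , e) ∷ q) =
    within-++ (within-reverse q) ((within-head q , ~-sym e) ∷ [ p ])

  within-map : ∀ {Q : Fin n → Set} → (∀ {v} → P v → Q v) → Within P u v → Within Q u v
  within-map f [ p ]         = [ f p ]
  within-map f ((p , e) ∷ q) = (f p , e) ∷ within-map f q

  walk⇒within : ∀ {m} → Walk G m u v → Within (λ _ → ⊤) u v
  walk⇒within []      = [ tt ]
  walk⇒within (e ∷ p) = (tt , e) ∷ walk⇒within p

  path-suffix : Path w ys v → All P (w ∷ ys) → u ∈ (w ∷ ys) →
                ∃[ zs ] Path u zs v × All P (u ∷ zs)
  path-suffix p            ps       (here refl) = _ , p , ps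
  path-suffix (step _ _ p) (_ ∷ ps) (there i)   = path-suffix p ps i

  -- Loop erasure: if the new first vertex already occurs on the path, the path is restarted from
  -- that occurrence.
  within⇒path : Within P u v → ∃[ ys ] Path u ys v × All P (u ∷ ys)
  within⇒path [ p ] = [] , [] , p ∷ []
  within⇒path (_∷_ {u = u} {w = w} (p , e) q) with within⇒path q
  ... | ys , r , ps with _∈?_ Fin._≟_ u (w ∷ ys)
  ...   | yes i = path-suffix r ps i
  ...   | no ∉  = w ∷ ys , step e (¬Any⇒All¬ (w ∷ ys) ∉) r , p ∷ ps

  path⇒walk : Path u ys v → Walk G (length ys) u v
  path⇒walk []           = []
  path⇒walk (step e _ p) = e ∷ path⇒walk p

  lookup-injective : Path u ys v → Injective _≡_ _≡_ (lookup (u ∷ ys))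
  lookup-injective p            {zero}  {zero}  _  = refl
  lookup-injective (step _ a _) {zero}  {suc j} eq = contradiction eq (All.lookup a (∈-lookup j))
  lookup-injective (step _ a _) {suc i} {zero}  eq = contradiction (sym eq) (All.lookup a (∈-lookup i))
  lookup-injective (step _ _ p) {suc i} {suc j} eq = cong suc (lookup-injective p eq)

  lookup-step : Path u ys v → ∀ i → lookup (u ∷ ys) (inject₁ i) ~ lookup (u ∷ ys) (suc i)
  lookup-step (step e _ p) zero    = e
  lookup-step (step _ _ p) (suc i) = lookup-step p i

  lookup-last : Path u ys v → lookup (u ∷ ys) (fromℕ (length ys)) ≡ v
  lookup-last []           = refl
  lookup-last (step _ _ p) = lookup-last p

  -- Erasing loops leaves a path from `a` to `b` that misses `x`, and `x` closes it up. Since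
  -- `a ≢ b` the path has an edge, which gives the three vertices that a `Cycle` requires.
  neighbours-within⇒cycle : ∀ {a b} → x ~ a → x ~ b → a ≢ b → Within (x ≢_) a b → Cycle G
  neighbours-within⇒cycle {x = x} {a = a} x~a x~b a≢b q with within⇒path q
  ... | []     , []             , _  = contradiction refl a≢b
  ... | y ∷ ys , p@(step _ _ _) , ps = record
    { m        = length ys
    ; c        = lookup (x ∷ a ∷ y ∷ ys)
    ; distinct = lookup-injective p′
    ; steps    = lookup-step p′
    ; closing  = subst (_~ _) (sym (lookup-last p′)) (~-sym x~b)
    }
    where p′ = step x~a ps p

  dist≤ : ∀ {m} → Walk G m u v → dist G u v ≤ m
  dist≤ {u} {v} = least-≤ n (λ m → walk? G m u v)

  dist-refl : dist G u u ≡ 0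
  dist-refl = n≤0⇒n≡0 (dist≤ [])

  module _ (connected : Connected G) where

    -- A path repeats no vertex, so it has fewer than `n` edges. Thus `dist` never falls back on its
    -- default `n` here, and is the length of an actual walk.
    dist<n : ∀ u v → dist G u v < n
    dist<n u v with within⇒path (walk⇒within (proj₂ (connected u v)))
    ... | ys , p , _ = ≤-<-trans (dist≤ (path⇒walk p)) (Fin.injective⇒≤ (lookup-injective p))

    geodesic : ∀ u v → Walk G (dist G u v) u v
    geodesic u v = least-satisfies n (λ m → walk? G m u v) (dist<n u v)

    dist≡0⇒≡ : dist G u v ≡ 0 → u ≡ v
    dist≡0⇒≡ {u} {v} d≡0 with dist G u v | geodesic u v | d≡0
    ... | zero | [] | _ = refl

    dist-neighbour : u ~ w → dist G u v ≤ suc (dist G w v)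
    dist-neighbour {w = w} {v} e = dist≤ (e ∷ geodesic w v)

    dist-neighbourʳ : u ~ w → dist G v w ≤ dist G v u + 1
    dist-neighbourʳ {u} {v = v} e = dist≤ (walk-++ (geodesic v u) (e ∷ []))

-- Rooted trees and the Mostar index through subtree sizes.

-- A common interface for the tree T, rooted by distances, and for the numbered model, rooted by
-- arithmetic. `edge-parent` carries acyclicity: every edge joins a vertex to its parent.
record Rooting {n : ℕ} (G : Graph (Fin n)) : Set where
  open Graph G
  field
    root         : Fin n
    parent       : Fin n → Fin n
    depth        : Fin n → ℕ
    depth-root   : depth root ≡ 0
    depth-parent : ∀ {v} → v ≢ root → depth v ≡ suc (depth (parent v))
    parent-edge  : ∀ {v} → v ≢ root → v ~ parent v
    edge-parent  : ∀ {u v} → u ~ v → (u ≢ root × parent u ≡ v) ⊎ (v ≢ root × parent v ≡ u)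

module Rooted {n : ℕ} {G : Graph (Fin n)} (R : Rooting G) where
  open Graph G
  open Rooting R
  open Paths G

  private variable
    u v w : Fin n

  infix 4 _↑_ _↑?_ _⊑_ _⊑?_

  nonroot? : Decidable (_≢ root)
  nonroot? v = ¬? (v Fin.≟ root)

  _↑_ : Fin n → Fin n → Set
  u ↑ v = u ≢ root × parent u ≡ v

  abstract
    _↑?_ : ∀ u v → Dec (u ↑ v)
    u ↑? v = nonroot? u ×-dec (parent u Fin.≟ v)

    ⟦↑⟧ : ∀ u v → ⟦ u ↑? v ⟧ ≡ ⟦ nonroot? u ⟧ * ⟦ parent u Fin.≟ v ⟧
    ⟦↑⟧ u v = ⟦⟧-× (nonroot? u) (parent u Fin.≟ v)

  ↑⇒~ : u ↑ v → u ~ v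
  ↑⇒~ (nr , refl) = parent-edge nr

  ↑⇒depth : u ↑ v → depth u ≡ suc (depth v)
  ↑⇒depth (nr , refl) = depth-parent nr

  depth≡0⇒root : depth v ≡ 0 → v ≡ root
  depth≡0⇒root {v} d≡0 with v Fin.≟ root
  ... | yes v≡root = v≡root
  ... | no nr      = contradiction (trans (sym (depth-parent nr)) d≡0) λ ()

  suc-depth⇒nonroot : ∀ {d} → depth v ≡ suc d → v ≢ root
  suc-depth⇒nonroot d≡ refl = contradiction (trans (sym depth-root) d≡) λ ()

  nonroot⇒0<depth : v ≢ root → 0 < depth v
  nonroot⇒0<depth nr = subst (0 <_) (sym (depth-parent nr)) z<s

  parent-depth : ∀ {d} → depth v ≡ suc d → depth (parent v) ≡ d
  parent-depth d≡ = suc-injective (trans (sym (depth-parent (suc-depth⇒nonroot d≡))) d≡)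

  connected : Connected G
  connected u v = _ , walk-++ (proj₂ (climb _ refl)) (proj₂ (walk-reverse (proj₂ (climb _ refl))))
    where
    climb : ∀ {v} d → depth v ≡ d → ∃[ m ] Walk G m v root
    climb zero    d≡ rewrite depth≡0⇒root d≡ = 0 , []
    climb (suc d) d≡ = _ , parent-edge (suc-depth⇒nonroot d≡) ∷ proj₂ (climb d (parent-depth d≡))

  -- On a cycle, both neighbours of a deepest vertex would have to be its parent.
  acyclic : ¬ Cycle G
  acyclic C with extremal (λ i j → depth (c j) ≤ depth (c i)) (λ p q → ≤-trans q p)
    (λ i j → ≤-total _ _)
    where open Cycle C
  ... | i , deepest = go i deepest
    where
    open Cycle C

    two-neighbours : ∀ {i a b} → (∀ j → depth (c j) ≤ depth (c i)) →
      c i ~ c a → c i ~ c b → a ≡ b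
    two-neighbours {i} deepest e e′ = distinct (trans (sym (to-parent e)) (to-parent e′))
      where
      to-parent : ∀ {a} → c i ~ c a → parent (c i) ≡ c a
      to-parent e with edge-parent e
      ... | inj₁ (_ , p) = p
      ... | inj₂ q = contradiction (deepest _) (<⇒≱ (≤-reflexive (sym (↑⇒depth q))))

    go : ∀ i → (∀ j → depth (c j) ≤ depth (c i)) → ⊥
    go zero deepest with two-neighbours deepest (steps zero) (~-sym closing)
    ... | ()
    go (suc i) deepest with view i
    ... | ‵fromℕ with two-neighbours deepest closing (~-sym (steps i))
    ...   | ()
    go (suc i) deepest | ‵inject₁ j
      with two-neighbours deepest (steps (suc j)) (~-sym (steps (inject₁ j)))
    -- The two neighbours carry the indices `j + 2` and `j`.
    ...   | eq = m+1+n≢n 1 (trans (cong toℕ eq) (trans (Fin.toℕ-inject₁ _) (Fin.toℕ-inject₁ j)))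

  data _⊑_ : Fin n → Fin n → Set where
    here : v ⊑ v
    up   : w ≢ root → parent w ⊑ v → w ⊑ v

  ⊑⇒depth : w ⊑ v → depth v ≤ depth w
  ⊑⇒depth here      = ≤-refl
  ⊑⇒depth (up nr p) = ≤-trans (⊑⇒depth p) (≤-trans (n≤1+n _) (≤-reflexive (sym (depth-parent nr))))

  parent⋢ : v ≢ root → ¬ (parent v ⊑ v)
  parent⋢ nr p = <⇒≱ (≤-reflexive (sym (depth-parent nr))) (⊑⇒depth p)

  ⊑-parent : v ≢ root → w ⊑ v → w ⊑ parent v
  ⊑-parent nr here       = up nr here
  ⊑-parent nr (up nr′ p) = up nr′ (⊑-parent nr p)

  ⊑-root⁻ : root ⊑ v → v ≡ root
  ⊑-root⁻ here      = refl
  ⊑-root⁻ (up nr _) = contradiction refl nr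

  ⊑-parent⁻ : w ≢ v → w ⊑ v → parent w ⊑ v
  ⊑-parent⁻ w≢v here     = contradiction refl w≢v
  ⊑-parent⁻ w≢v (up _ p) = p

  abstract
    _⊑?_ : ∀ w v → Dec (w ⊑ v)
    w ⊑? v = decide (depth w) refl
      where
      decide : ∀ d {w} → depth w ≡ d → Dec (w ⊑ v)
      decide d {w} d≡ with w Fin.≟ v
      ... | yes refl = yes here
      decide zero    d≡ | no w≢v rewrite depth≡0⇒root d≡ = no (w≢v ∘ sym ∘ ⊑-root⁻)
      decide (suc d) d≡ | no w≢v =
        map′ (up (suc-depth⇒nonroot d≡)) (⊑-parent⁻ w≢v) (decide d (parent-depth d≡))

  subtree-size : Fin n → ℕ
  subtree-size v = count (_⊑? v)

  -- Besides its own branch, the branches containing `w` are those containing its parent, so each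
  -- step away from the root adds one.
  ancestors : ∀ w → ∑ (λ v → ⟦ nonroot? v ⟧ * ⟦ w ⊑? v ⟧) ≡ depth w
  ancestors w = go (depth w) refl
    where
    open ≡-Reasoning
    go : ∀ d {w} → depth w ≡ d → ∑ (λ v → ⟦ nonroot? v ⟧ * ⟦ w ⊑? v ⟧) ≡ d
    go zero {w} d≡ rewrite depth≡0⇒root d≡ = trans (∑-cong vanish) (trans (∑-const n 0) (*-zeroʳ n))
      where
      vanish : ∀ v → ⟦ nonroot? v ⟧ * ⟦ root ⊑? v ⟧ ≡ 0
      vanish v with v Fin.≟ root
      ... | yes _ = refl
      ... | no nr = cong (1 *_) (⟦⟧-false (root ⊑? v) (nr ∘ ⊑-root⁻))
    go (suc d) {w} d≡ = begin
      ∑ (λ v → ⟦ nonroot? v ⟧ * ⟦ w ⊑? v ⟧)                                  ≡⟨ ∑-cong split ⟩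
      ∑ (λ v → ⟦ w Fin.≟ v ⟧ + ⟦ nonroot? v ⟧ * ⟦ parent w ⊑? v ⟧)
        ≡⟨ ∑-+ (λ v → ⟦ w Fin.≟ v ⟧) (λ v → ⟦ nonroot? v ⟧ * ⟦ parent w ⊑? v ⟧) ⟩
      count (w Fin.≟_) + ∑ (λ v → ⟦ nonroot? v ⟧ * ⟦ parent w ⊑? v ⟧)
        ≡⟨ cong₂ _+_ (count-singleton w) (go d (parent-depth d≡)) ⟩
      suc d                                                                  ∎
      where
      nr = suc-depth⇒nonroot d≡
      split : ∀ v → ⟦ nonroot? v ⟧ * ⟦ w ⊑? v ⟧ ≡ ⟦ w Fin.≟ v ⟧ + ⟦ nonroot? v ⟧ * ⟦ parent w ⊑? v ⟧
      split v with w Fin.≟ v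
      ... | yes refl rewrite ⟦⟧-true (nonroot? w) nr | ⟦⟧-true (w ⊑? w) here
                           | ⟦⟧-false (parent w ⊑? w) (parent⋢ nr) = refl
      ... | no w≢v = cong (⟦ nonroot? v ⟧ *_) (⟦⟧-cong (w ⊑? v) (parent w ⊑? v) (⊑-parent⁻ w≢v) (up nr))

  total-depth : ℕ
  total-depth = ∑ depth

  -- Counts the pairs `w ⊑ v` with `v` below the root in two ways, by `v` and by `w`.
  ∑-subtree-size : ∑ (λ v → ⟦ nonroot? v ⟧ * subtree-size v) ≡ total-depth
  ∑-subtree-size = begin
    ∑ (λ v → ⟦ nonroot? v ⟧ * subtree-size v)
      ≡⟨ ∑-cong (λ v → ∑-*ˡ ⟦ nonroot? v ⟧ (λ w → ⟦ w ⊑? v ⟧)) ⟨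
    ∑ (λ v → ∑ (λ w → ⟦ nonroot? v ⟧ * ⟦ w ⊑? v ⟧))
      ≡⟨ ∑-swap (λ v w → ⟦ nonroot? v ⟧ * ⟦ w ⊑? v ⟧) ⟩
    ∑ (λ w → ∑ (λ v → ⟦ nonroot? v ⟧ * ⟦ w ⊑? v ⟧))            ≡⟨ ∑-cong ancestors ⟩
    total-depth                                                ∎
    where open ≡-Reasoning

  #nonroot : ℕ
  #nonroot = count nonroot?

  suc-#nonroot : suc #nonroot ≡ n
  suc-#nonroot = begin
    1 + count nonroot?                        ≡⟨ cong (_+ count nonroot?) (count-singleton root) ⟨
    count (root Fin.≟_) + count nonroot?
      ≡⟨ cong (_+ count nonroot?) (count-cong (root Fin.≟_) (Fin._≟ root) sym sym) ⟩
    count (Fin._≟ root) + count nonroot?      ≡⟨ count-∁ (Fin._≟ root) ⟩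
    n                                         ∎
    where open ≡-Reasoning

  depth≤#nonroot : ∀ w → depth w ≤ #nonroot
  depth≤#nonroot w = ≤-trans (≤-reflexive (sym (ancestors w)))
    (∑-mono λ v → ≤-trans (*-monoʳ-≤ ⟦ nonroot? v ⟧ (⟦⟧≤1 (w ⊑? v))) (≤-reflexive (*-identityʳ _)))

  depth<n : ∀ w → depth w < n
  depth<n w = ≤-trans (s≤s (depth≤#nonroot w)) (≤-reflexive suc-#nonroot)

  -- The edge from v to its parent is the only one that leaves the subtree at v.
  walk-out : v ≢ root → ∀ {m} → w ⊑ v → Walk G m w (parent v) → ∃[ l ] l < m × Walk G l w v
  walk-out nr w⊑v []      = contradiction w⊑v (parent⋢ nr)
  walk-out {v} nr {suc m} w⊑v (_∷_ {v = x} e p) with x ⊑? v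
  ... | yes x⊑v with walk-out nr x⊑v p
  ...   | l , l<m , q = suc l , s<s l<m , e ∷ q
  walk-out nr w⊑v (e ∷ p) | no x⋢v with edge-parent e
  ... | inj₂ (nr′ , refl) = contradiction (up nr′ w⊑v) x⋢v
  ... | inj₁ (nr′ , refl) with w⊑v
  ...   | here   = 0 , z<s , []
  ...   | up _ q = contradiction q x⋢v

  walk-in : v ≢ root → ∀ {m} → ¬ w ⊑ v → Walk G m w v → ∃[ l ] l < m × Walk G l w (parent v)
  walk-in nr w⋢v [] = contradiction here w⋢v
  walk-in {v} nr {suc m} w⋢v (_∷_ {v = x} e p) with x ⊑? v
  ... | no x⋢v with walk-in nr x⋢v p
  ...   | l , l<m , q = suc l , s<s l<m , e ∷ q
  walk-in nr w⋢v (e ∷ p) | yes x⊑v with edge-parent e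
  ... | inj₁ (nr′ , refl) = contradiction (up nr′ x⊑v) w⋢v
  ... | inj₂ (nr′ , refl) with x⊑v
  ...   | here   = 0 , z<s , []
  ...   | up _ q = contradiction q w⋢v

  -- A geodesic from inside the branch to the parent of `v` has to leave through `v`, so it passes
  -- `v` before it ends.
  ⊑⇒closer : v ≢ root → w ⊑ v → dist G w v < dist G w (parent v)
  ⊑⇒closer {v} {w} nr w⊑v with walk-out nr w⊑v (geodesic connected w (parent v))
  ... | _ , l< , q = ≤-<-trans (dist≤ q) l<

  ⋢⇒closer : v ≢ root → ¬ w ⊑ v → dist G w (parent v) < dist G w v
  ⋢⇒closer {v} {w} nr w⋢v with walk-in nr w⋢v (geodesic connected w v)
  ... | _ , l< , q = ≤-<-trans (dist≤ q) l<

  closer⇒⊑ : v ≢ root → dist G w v < dist G w (parent v) → w ⊑ v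
  closer⇒⊑ {v} {w} nr lt with w ⊑? v
  ... | yes p = p
  ... | no ¬p = contradiction lt (<⇒≯ (⋢⇒closer nr ¬p))

  closer⇒⋢ : v ≢ root → dist G w (parent v) < dist G w v → ¬ w ⊑ v
  closer⇒⋢ nr lt p = contradiction lt (<⇒≯ (⊑⇒closer nr p))

  closer-child : v ≢ root → closer G v (parent v) ≡ subtree-size v
  closer-child {v} nr =
    count-cong (λ w → dist G w v <? dist G w (parent v)) (_⊑? v) (closer⇒⊑ nr) (⊑⇒closer nr)

  subtree-size-∁ : ∀ v → count (λ w → ¬? (w ⊑? v)) ≡ n ∸ subtree-size v
  subtree-size-∁ v = sym (trans (cong (_∸ subtree-size v) (sym (count-∁ (_⊑? v))))
    (m+n∸m≡n (subtree-size v) _))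

  closer-parent : v ≢ root → closer G (parent v) v ≡ n ∸ subtree-size v
  closer-parent {v} nr = trans
    (count-cong (λ w → dist G w (parent v) <? dist G w v) (λ w → ¬? (w ⊑? v)) (closer⇒⋢ nr)
      (⋢⇒closer nr))
    (subtree-size-∁ v)

  imbalance : Fin n → ℕ
  imbalance v = ∣ subtree-size v - (n ∸ subtree-size v) ∣

  imbalance-edge : u ↑ v → ∣ closer G u v - closer G v u ∣ ≡ imbalance u
  imbalance-edge (nr , refl) = cong₂ ∣_-_∣ (closer-child nr) (closer-parent nr)

  ↑-asym : u ↑ v → ¬ v ↑ u
  ↑-asym p q = <⇒≢ (≤-trans (n≤1+n _)
    (≤-reflexive (sym (trans (↑⇒depth p) (cong suc (↑⇒depth q)))))) refl

  ∑-parents : ∀ u (f : Fin n → ℕ) → ∑ (λ v → ⟦ u ↑? v ⟧ * f v) ≡ ⟦ nonroot? u ⟧ * f (parent u)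
  ∑-parents u f = begin
    ∑ (λ v → ⟦ u ↑? v ⟧ * f v)
      ≡⟨ ∑-cong (λ v → cong (_* f v) (⟦↑⟧ u v)) ⟩
    ∑ (λ v → ⟦ nonroot? u ⟧ * ⟦ parent u Fin.≟ v ⟧ * f v)
      ≡⟨ ∑-cong (λ v → *-assoc ⟦ nonroot? u ⟧ ⟦ parent u Fin.≟ v ⟧ (f v)) ⟩
    ∑ (λ v → ⟦ nonroot? u ⟧ * (⟦ parent u Fin.≟ v ⟧ * f v))
      ≡⟨ ∑-*ˡ ⟦ nonroot? u ⟧ (λ v → ⟦ parent u Fin.≟ v ⟧ * f v) ⟩
    ⟦ nonroot? u ⟧ * ∑ (λ v → ⟦ parent u Fin.≟ v ⟧ * f v)
      ≡⟨ cong (⟦ nonroot? u ⟧ *_) (∑-pick (parent u) f) ⟩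
    ⟦ nonroot? u ⟧ * f (parent u)                                   ∎
    where open ≡-Reasoning

  -- `Mo` lists an edge by `u < v`, but a parent may carry the smaller or the larger number. Each
  -- edge term is therefore split into `B u v + B v u`, of which at most one is nonzero; after
  -- exchanging the names in the second half, the conditions `u < v` and `v < u` together admit
  -- every parent edge exactly once.
  Mo≡∑-imbalance : Mo G ≡ ∑ (λ u → ⟦ nonroot? u ⟧ * imbalance u)
  Mo≡∑-imbalance = begin
    Mo G                                                       ≡⟨ ∑-cong (λ u → ∑-cong (summand u)) ⟩
    ∑ (λ u → ∑ (λ v → below u v * B u v + below u v * B v u))
      ≡⟨ ∑-cong (λ u → ∑-+ (λ v → below u v * B u v) (λ v → below u v * B v u)) ⟩
    ∑ (λ u → ∑ (λ v → below u v * B u v) + ∑ (λ v → below u v * B v u))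
      ≡⟨ ∑-+ (λ u → ∑ (λ v → below u v * B u v)) (λ u → ∑ (λ v → below u v * B v u)) ⟩
    ∑ (λ u → ∑ (λ v → below u v * B u v)) + ∑ (λ u → ∑ (λ v → below u v * B v u))
      ≡⟨ cong (∑ (λ u → ∑ (λ v → below u v * B u v)) +_) (∑-swap (λ u v → below u v * B v u)) ⟩
    ∑ (λ u → ∑ (λ v → below u v * B u v)) + ∑ (λ u → ∑ (λ v → below v u * B u v))
      ≡⟨ ∑-+ (λ u → ∑ (λ v → below u v * B u v)) (λ u → ∑ (λ v → below v u * B u v)) ⟨
    ∑ (λ u → ∑ (λ v → below u v * B u v) + ∑ (λ v → below v u * B u v))
      ≡⟨ ∑-cong (λ u → ∑-+ (λ v → below u v * B u v) (λ v → below v u * B u v)) ⟨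
    ∑ (λ u → ∑ (λ v → below u v * B u v + below v u * B u v))
      ≡⟨ ∑-cong (λ u → ∑-cong (either-order u)) ⟩
    ∑ (λ u → ∑ (λ v → B u v))
      ≡⟨ ∑-cong (λ u → ∑-parents u (λ _ → imbalance u)) ⟩
    ∑ (λ u → ⟦ nonroot? u ⟧ * imbalance u)                     ∎
    where
    open ≡-Reasoning
    below B : Fin n → Fin n → ℕ
    below u v = ⟦ u Fin.<? v ⟧
    B u v = ⟦ u ↑? v ⟧ * imbalance u

    edge-term : ∀ u v → ⟦ u ~? v ⟧ * ∣ closer G u v - closer G v u ∣ ≡ B u v + B v u
    edge-term u v with u ~? v
    ... | no ¬e = sym (cong₂ _+_ (cong (_* imbalance u) (⟦⟧-false (u ↑? v) (¬e ∘ ↑⇒~)))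
                                 (cong (_* imbalance v) (⟦⟧-false (v ↑? u) (¬e ∘ ~-sym ∘ ↑⇒~))))
    ... | yes e with edge-parent e
    ...   | inj₁ p = trans (trans (*-identityˡ _) (imbalance-edge p)) (sym (trans
      (cong₂ _+_ (cong (_* imbalance u) (⟦⟧-true (u ↑? v) p))
        (cong (_* imbalance v) (⟦⟧-false (v ↑? u) (↑-asym p))))
      (trans (+-identityʳ _) (*-identityˡ _))))
    ...   | inj₂ p = trans
      (trans (*-identityˡ _) (trans (∣-∣-comm (closer G u v) (closer G v u)) (imbalance-edge p)))
        (sym (trans
      (cong₂ _+_ (cong (_* imbalance u) (⟦⟧-false (u ↑? v) (↑-asym p)))
        (cong (_* imbalance v) (⟦⟧-true (v ↑? u) p)))
      (*-identityˡ _)))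

    summand : ∀ u v →
      (if does ((u Fin.<? v) ×-dec (u ~? v)) then ∣ closer G u v - closer G v u ∣ else 0)
      ≡ below u v * B u v + below u v * B v u
    summand u v = trans (if-× (u Fin.<? v) (u ~? v))
      (trans (cong (below u v *_) (edge-term u v)) (*-distribˡ-+ (below u v) (B u v) (B v u)))

    either-order : ∀ u v → below u v * B u v + below v u * B u v ≡ B u v
    either-order u v = trans (sym (*-distribʳ-+ (B u v) (below u v) (below v u))) (go (u ↑? v))
      where
      go : Dec (u ↑ v) → (below u v + below v u) * B u v ≡ B u v
      go (no ¬p) = trans (cong ((below u v + below v u) *_) B≡0)
        (trans (*-zeroʳ (below u v + below v u)) (sym B≡0))
        where
        B≡0 : B u v ≡ 0
        B≡0 = cong (_* imbalance u) (⟦⟧-false (u ↑? v) ¬p)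
      go (yes p) with Fin.<-cmp u v
      ... | tri< u<v _ v≮u = trans
        (cong (_* B u v) (cong₂ _+_ (⟦⟧-true (u Fin.<? v) u<v) (⟦⟧-false (v Fin.<? u) v≮u)))
          (*-identityˡ _)
      ... | tri> u≮v _ v<u = trans
        (cong (_* B u v) (cong₂ _+_ (⟦⟧-false (u Fin.<? v) u≮v) (⟦⟧-true (v Fin.<? u) v<u)))
          (*-identityˡ _)
      ... | tri≈ _ refl _  = contradiction (↑⇒~ p) ~-irrefl

  subtree-size≤n : ∀ v → subtree-size v ≤ n
  subtree-size≤n v = count≤n (_⊑? v)

  #nonroot*n≡∑ : #nonroot * n ≡ ∑ (λ v → ⟦ nonroot? v ⟧ * n)
  #nonroot*n≡∑ = begin
    #nonroot * n                          ≡⟨ *-comm #nonroot n ⟩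
    n * #nonroot                          ≡⟨ ∑-*ˡ n (λ v → ⟦ nonroot? v ⟧) ⟨
    ∑ (λ v → n * ⟦ nonroot? v ⟧)          ≡⟨ ∑-cong (λ v → *-comm n ⟦ nonroot? v ⟧) ⟩
    ∑ (λ v → ⟦ nonroot? v ⟧ * n)          ∎
    where open ≡-Reasoning

  Mo+2*total-depth : Mo G + 2 * total-depth ≡ ∑
    (λ v → ⟦ nonroot? v ⟧ * (imbalance v + 2 * subtree-size v))
  Mo+2*total-depth = begin
    Mo G + 2 * total-depth
      ≡⟨ cong₂ (λ a b → a + 2 * b) Mo≡∑-imbalance (sym ∑-subtree-size) ⟩
    ∑ f + 2 * ∑ g                                            ≡⟨ cong (∑ f +_) (∑-*ˡ 2 g) ⟨
    ∑ f + ∑ (λ v → 2 * g v)                                  ≡⟨ ∑-+ f (λ v → 2 * g v) ⟨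
    ∑ (λ v → f v + 2 * g v)
      ≡⟨ ∑-cong (λ v → factor ⟦ nonroot? v ⟧ (imbalance v) (subtree-size v)) ⟩
    ∑ (λ v → ⟦ nonroot? v ⟧ * (imbalance v + 2 * subtree-size v))   ∎
    where
    open ≡-Reasoning
    f g : Fin n → ℕ
    f v = ⟦ nonroot? v ⟧ * imbalance v
    g v = ⟦ nonroot? v ⟧ * subtree-size v
    factor : ∀ a b c → a * b + 2 * (a * c) ≡ a * (b + 2 * c)
    factor = solve-∀

  -- Edge by edge this is `t ≤ s + ∣ s - t ∣` with `t = n ∸ s`. The total depth stands beside `Mo G`
  -- so that it need not be subtracted from a truncated difference. Later this is applied to the
  -- competitor.
  Mo-lower : #nonroot * n ≤ Mo G + 2 * total-depth
  Mo-lower = begin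
    #nonroot * n                         ≡⟨ #nonroot*n≡∑ ⟩
    ∑ (λ v → ⟦ nonroot? v ⟧ * n)         ≤⟨ ∑-mono (λ v → *-monoʳ-≤ ⟦ nonroot? v ⟧ (pointwise v)) ⟩
    ∑ (λ v → ⟦ nonroot? v ⟧ * (imbalance v + 2 * subtree-size v))   ≡⟨ Mo+2*total-depth ⟨
    Mo G + 2 * total-depth               ∎
    where
    open ≤-Reasoning
    pointwise : ∀ v → n ≤ imbalance v + 2 * subtree-size v
    pointwise v = begin
      n                          ≡⟨ m+[n∸m]≡n (subtree-size≤n v) ⟨
      s + t                      ≤⟨ +-monoʳ-≤ s (m≤n+∣n-m∣ t s) ⟩
      s + (s + ∣ s - t ∣)        ≡⟨ rearrange s ∣ s - t ∣ ⟩
      ∣ s - t ∣ + 2 * s          ∎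
      where
      s = subtree-size v
      t = n ∸ s
      rearrange : ∀ a b → a + (a + b) ≡ b + 2 * a
      rearrange = solve-∀

  -- If no branch exceeds half of the vertices, the absolute values open with a definite sign and
  -- each edge gives exactly `n`.
  Mo-upper : (∀ v → v ≢ root → subtree-size v ≤ n ∸ subtree-size v) → Mo G + 2 * total-depth ≤
    #nonroot * n
  Mo-upper small = begin
    Mo G + 2 * total-depth               ≡⟨ Mo+2*total-depth ⟩
    ∑ (λ v → ⟦ nonroot? v ⟧ * (imbalance v + 2 * subtree-size v))   ≤⟨ ∑-mono pointwise ⟩
    ∑ (λ v → ⟦ nonroot? v ⟧ * n)         ≡⟨ #nonroot*n≡∑ ⟨
    #nonroot * n                         ∎
    where
    open ≤-Reasoning
    pointwise : ∀ v → ⟦ nonroot? v ⟧ * (imbalance v + 2 * subtree-size v) ≤ ⟦ nonroot? v ⟧ * n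
    pointwise v with v Fin.≟ root
    ... | yes _ = z≤n
    ... | no nr = +-monoˡ-≤ 0 (begin
      ∣ s - t ∣ + 2 * s          ≡⟨ cong (_+ 2 * s) (m≤n⇒∣m-n∣≡n∸m (small v nr)) ⟩
      t ∸ s + 2 * s              ≡⟨ rearrange (t ∸ s) s ⟩
      s + (s + (t ∸ s))          ≡⟨ cong (s +_) (m+[n∸m]≡n (small v nr)) ⟩
      s + t                      ≡⟨ m+[n∸m]≡n (subtree-size≤n v) ⟩
      n                          ∎)
      where
      s = subtree-size v
      t = n ∸ s
      rearrange : ∀ a b → a + 2 * b ≡ b + (b + a)
      rearrange = solve-∀

-- Children, leaves and level sizes.

module Levels {n : ℕ} {G : Graph (Fin n)} (R : Rooting G) where
  open Graph G
  open Rooting R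
  open Paths G
  open Rooted R

  private variable
    u v w : Fin n

  children : Fin n → ℕ
  children v = count (_↑? v)

  degree≡ : ∀ v → degree G v ≡ ⟦ nonroot? v ⟧ + children v
  degree≡ v = begin
    degree G v                                            ≡⟨ ∑-cong pointwise ⟩
    ∑ (λ u → ⟦ v ↑? u ⟧ * 1 + ⟦ u ↑? v ⟧)
      ≡⟨ ∑-+ (λ u → ⟦ v ↑? u ⟧ * 1) (λ u → ⟦ u ↑? v ⟧) ⟩
    ∑ (λ u → ⟦ v ↑? u ⟧ * 1) + children v
      ≡⟨ cong (_+ children v) (∑-parents v (λ _ → 1)) ⟩
    ⟦ nonroot? v ⟧ * 1 + children v
      ≡⟨ cong (_+ children v) (*-identityʳ ⟦ nonroot? v ⟧) ⟩
    ⟦ nonroot? v ⟧ + children v                           ∎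
    where
    open ≡-Reasoning
    pointwise : ∀ u → ⟦ v ~? u ⟧ ≡ ⟦ v ↑? u ⟧ * 1 + ⟦ u ↑? v ⟧
    pointwise u with v ~? u
    ... | no ¬e = sym (cong₂ (λ a b → a * 1 + b) (⟦⟧-false (v ↑? u) (¬e ∘ ↑⇒~))
      (⟦⟧-false (u ↑? v) (¬e ∘ ~-sym ∘ ↑⇒~)))
    ... | yes e with edge-parent e
    ...   | inj₁ p = sym (cong₂ (λ a b → a * 1 + b) (⟦⟧-true (v ↑? u) p) (⟦⟧-false (u ↑? v) (↑-asym p)))
    ...   | inj₂ p = sym (cong₂ (λ a b → a * 1 + b) (⟦⟧-false (v ↑? u) (↑-asym p)) (⟦⟧-true (u ↑? v) p))

  Leaf : Fin n → Set
  Leaf v = v ≢ root × children v ≡ 0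

  leaf? : Decidable Leaf
  leaf? v = nonroot? v ×-dec (children v ≟ 0)

  leaf⇒odd : Leaf v → OddVertex G v
  leaf⇒odd {v} (nr , c≡0) = cong (_% 2) (trans (degree≡ v) (cong₂ _+_ (⟦⟧-true (nonroot? v) nr) c≡0))

  #leaf : ℕ
  #leaf = count leaf?

  deep : ℕ → ℕ
  deep i = count (λ v → i ≤? depth v)

  level : ℕ → ℕ
  level i = count (λ v → depth v ≟ i)

  deep-1 : deep 1 ≡ #nonroot
  deep-1 = count-cong (λ v → 1 ≤? depth v) nonroot?
    (λ { 1≤d refl → <⇒≢ 1≤d (sym depth-root) }) nonroot⇒0<depth

  deep-split : ∀ i → deep i ≡ level i + deep (suc i)
  deep-split i = trans (∑-cong pointwise) (∑-+ (λ v → ⟦ depth v ≟ i ⟧) (λ v → ⟦ suc i ≤? depth v ⟧))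
    where
    pointwise : ∀ v → ⟦ i ≤? depth v ⟧ ≡ ⟦ depth v ≟ i ⟧ + ⟦ suc i ≤? depth v ⟧
    pointwise v with <-cmp i (depth v)
    ... | tri< lt ne _ = trans (⟦⟧-true (i ≤? depth v) (<⇒≤ lt))
      (sym (cong₂ _+_ (⟦⟧-false (depth v ≟ i) (ne ∘ sym)) (⟦⟧-true (suc i ≤? depth v) lt)))
    ... | tri≈ nlt eq _ = trans (⟦⟧-true (i ≤? depth v) (≤-reflexive eq))
      (sym (cong₂ _+_ (⟦⟧-true (depth v ≟ i) (sym eq)) (⟦⟧-false (suc i ≤? depth v) nlt)))
    ... | tri> nlt ne gt = trans (⟦⟧-false (i ≤? depth v) (<⇒≱ gt))
      (sym (cong₂ _+_ (⟦⟧-false (depth v ≟ i) (ne ∘ sym)) (⟦⟧-false (suc i ≤? depth v) nlt)))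

  -- Counted from the child's side: the parent of a non-root `w` has depth at least `i` exactly when
  -- `w` has depth at least `i + 1`.
  ∑-children : ∀ i → ∑ (λ v → ⟦ i ≤? depth v ⟧ * children v) ≡ deep (suc i)
  ∑-children i = begin
    ∑ (λ v → ⟦ i ≤? depth v ⟧ * children v)
      ≡⟨ ∑-cong (λ v → ∑-*ˡ ⟦ i ≤? depth v ⟧ (λ w → ⟦ w ↑? v ⟧)) ⟨
    ∑ (λ v → ∑ (λ w → ⟦ i ≤? depth v ⟧ * ⟦ w ↑? v ⟧))
      ≡⟨ ∑-swap (λ v w → ⟦ i ≤? depth v ⟧ * ⟦ w ↑? v ⟧) ⟩
    ∑ (λ w → ∑ (λ v → ⟦ i ≤? depth v ⟧ * ⟦ w ↑? v ⟧))
      ≡⟨ ∑-cong (λ w → ∑-cong (λ v → *-comm ⟦ i ≤? depth v ⟧ ⟦ w ↑? v ⟧)) ⟩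
    ∑ (λ w → ∑ (λ v → ⟦ w ↑? v ⟧ * ⟦ i ≤? depth v ⟧))
      ≡⟨ ∑-cong (λ w → ∑-parents w (λ v → ⟦ i ≤? depth v ⟧)) ⟩
    ∑ (λ w → ⟦ nonroot? w ⟧ * ⟦ i ≤? depth (parent w) ⟧)      ≡⟨ ∑-cong pointwise ⟩
    deep (suc i)                                              ∎
    where
    open ≡-Reasoning
    pointwise : ∀ w → ⟦ nonroot? w ⟧ * ⟦ i ≤? depth (parent w) ⟧ ≡ ⟦ suc i ≤? depth w ⟧
    pointwise w with w Fin.≟ root
    ... | yes refl = sym (⟦⟧-false (suc i ≤? depth root)
      (λ lt → n≮0 (≤-trans lt (≤-reflexive depth-root))))
    ... | no nr    = trans (*-identityˡ _) (⟦⟧-cong (i ≤? depth (parent w)) (suc i ≤? depth w)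
      (λ le → ≤-trans (s≤s le) (≤-reflexive (sym (depth-parent nr))))
      (λ lt → s≤s⁻¹ (≤-trans lt (≤-reflexive (depth-parent nr)))))

  childless-or-parent : ∀ {d} (D? : Dec (d ≤ depth v)) → 1 ≤ d →
    ⟦ D? ⟧ ≤ ⟦ leaf? v ⟧ + ⟦ D? ⟧ * children v
  childless-or-parent     (no _)    _   = z≤n
  childless-or-parent {v} (yes d≤) 1≤d with children v ≟ 0
  ... | yes c≡0 = ≤-trans (≤-reflexive (sym (⟦⟧-true (leaf? v) (nr , c≡0)))) (m≤m+n _ _)
    where
    nr : v ≢ root
    nr refl = <⇒≢ (≤-trans 1≤d d≤) (sym depth-root)
  ... | no c≢0  = ≤-trans (n≢0⇒n>0 c≢0) (≤-trans (m≤m+n _ 0) (m≤n+m _ ⟦ leaf? v ⟧))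

  deep≤#leaf+deep : ∀ i → deep (suc i) ≤ #leaf + deep (2 + i)
  deep≤#leaf+deep i = begin
    deep (suc i)
      ≤⟨ ∑-mono (λ v → childless-or-parent (suc i ≤? depth v) (s≤s z≤n)) ⟩
    ∑ (λ v → ⟦ leaf? v ⟧ + ⟦ suc i ≤? depth v ⟧ * children v)
      ≡⟨ ∑-+ (λ v → ⟦ leaf? v ⟧) (λ v → ⟦ suc i ≤? depth v ⟧ * children v) ⟩
    #leaf + ∑ (λ v → ⟦ suc i ≤? depth v ⟧ * children v)
      ≡⟨ cong (#leaf +_) (∑-children (suc i)) ⟩
    #leaf + deep (2 + i)                                               ∎
    where open ≤-Reasoning

  -- Cancelling the deeper vertices on both sides takes the place of an injection that would choose
  -- a leaf under each vertex of the level.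
  level≤#leaf : ∀ i → level (suc i) ≤ #leaf
  level≤#leaf i = +-cancelʳ-≤ (deep (2 + i)) _ _
    (≤-trans (≤-reflexive (sym (deep-split (suc i)))) (deep≤#leaf+deep i))

  deep-lower : ∀ {r} → #leaf ≤ r → ∀ i → #nonroot ∸ r * i ≤ deep (suc i)
  deep-lower {r} leaves≤r zero    = ≤-reflexive (trans (cong (#nonroot ∸_) (*-zeroʳ r)) (sym deep-1))
  deep-lower {r} leaves≤r (suc i) = begin
    #nonroot ∸ r * suc i       ≡⟨ cong (#nonroot ∸_) (trans (*-suc r i) (+-comm r (r * i))) ⟩
    #nonroot ∸ (r * i + r)     ≡⟨ ∸-+-assoc #nonroot (r * i) r ⟨
    #nonroot ∸ r * i ∸ r       ≤⟨ ∸-monoˡ-≤ r (deep-lower leaves≤r i) ⟩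
    deep (suc i) ∸ r           ≤⟨ ∸-monoˡ-≤ r (≤-trans (deep≤#leaf+deep i) (+-monoˡ-≤ _ leaves≤r)) ⟩
    r + deep (2 + i) ∸ r       ≡⟨ m+n∸m≡n r _ ⟩
    deep (2 + i)               ∎
    where open ≤-Reasoning

  -- Layer-cake summation: `depth v` counts the `i` below it. The range `i < n` loses nothing
  -- because depths are less than `n`.
  total-depth≡∑-deep : total-depth ≡ ∑ {n} (λ i → deep (suc (toℕ i)))
  total-depth≡∑-deep = begin
    ∑ depth
      ≡⟨ ∑-cong (λ v → count-< (depth v) (<⇒≤ (depth<n v))) ⟨
    ∑ (λ v → ∑ {n} (λ i → ⟦ toℕ i <? depth v ⟧))
      ≡⟨ ∑-swap {n} {n} (λ v i → ⟦ toℕ i <? depth v ⟧) ⟩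
    ∑ {n} (λ i → deep (suc (toℕ i)))                         ∎
    where open ≡-Reasoning

  -- `tight` is the reverse of `deep≤#leaf+deep 0`, so the inequality holds with equality at every
  -- vertex: a non-root vertex is a leaf or has exactly one child.
  unique-child : #leaf + deep 2 ≤ deep 1 → v ≢ root → u ↑ v → w ↑ v → u ≡ w
  unique-child {v} tight nr = count-unique (_↑? v) (begin
    children v                                                   ≡⟨ *-identityˡ _ ⟨
    1 * children v                                               ≡⟨ cong (_* children v) d≥1 ⟨
    ⟦ 1 ≤? depth v ⟧ * children v                                ≤⟨ m≤n+m _ ⟦ leaf? v ⟧ ⟩
    ⟦ leaf? v ⟧ + ⟦ 1 ≤? depth v ⟧ * children v                  ≡⟨ ∑-squeeze pointwise sum≤ v ⟨
    ⟦ 1 ≤? depth v ⟧                                             ≤⟨ ⟦⟧≤1 (1 ≤? depth v) ⟩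
    1                                                            ∎)
    where
    open ≤-Reasoning
    d≥1 : ⟦ 1 ≤? depth v ⟧ ≡ 1
    d≥1 = ⟦⟧-true (1 ≤? depth v) (nonroot⇒0<depth nr)
    pointwise : ∀ v → ⟦ 1 ≤? depth v ⟧ ≤ ⟦ leaf? v ⟧ + ⟦ 1 ≤? depth v ⟧ * children v
    pointwise v = childless-or-parent (1 ≤? depth v) ≤-refl
    sum≤ : ∑ (λ v → ⟦ leaf? v ⟧ + ⟦ 1 ≤? depth v ⟧ * children v) ≤ deep 1
    sum≤ = begin
      ∑ (λ v → ⟦ leaf? v ⟧ + ⟦ 1 ≤? depth v ⟧ * children v)
        ≡⟨ ∑-+ (λ v → ⟦ leaf? v ⟧) (λ v → ⟦ 1 ≤? depth v ⟧ * children v) ⟩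
      #leaf + ∑ (λ v → ⟦ 1 ≤? depth v ⟧ * children v)             ≡⟨ cong (#leaf +_) (∑-children 1) ⟩
      #leaf + deep 2                                              ≤⟨ tight ⟩
      deep 1                                                      ∎

-- Rooting a tree by the distance to a vertex.

module TreeRooting {n : ℕ} {G : Graph (Fin n)} (tree : IsTree G) (c : Fin n) where
  open Graph G
  open Paths G

  private
    conn = proj₁ tree

    d : Fin n → ℕ
    d v = dist G v c

    variable
      u v w x : Fin n

  walk⇒within-ball : ∀ {m} → Walk G m v c → Within (λ w → d w ≤ m) v c
  walk⇒within-ball []      = [ dist≤ [] ]
  walk⇒within-ball (e ∷ p) = (dist≤ (e ∷ p) , e) ∷ within-map m≤n⇒m≤1+n (walk⇒within-ball p)

  -- A geodesic to c gets strictly closer to c, so it misses x unless it starts there.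
  within-avoiding : x ≢ v → d v ≤ d x → Within (x ≢_) v c
  within-avoiding {x} {v} x≢v dv≤dx = go (geodesic conn v c) dv≤dx x≢v
    where
    go : ∀ {m v} → Walk G m v c → m ≤ d x → x ≢ v → Within (x ≢_) v c
    go []      _    x≢v = [ x≢v ]
    go (e ∷ p) m<dx x≢v =
      (x≢v , e) ∷ within-map (λ { dx≤m refl → <⇒≱ m<dx dx≤m }) (walk⇒within-ball p)

  -- Two such neighbours reach `c` without meeting `x`, so they would be connected outside `x` and
  -- close a cycle. The comparisons are not strict because `farther-endpoint` must also cope with an
  -- edge whose ends might be equally far from `c`.
  closer-neighbour-unique : ∀ {a b} → x ~ a → x ~ b → d a ≤ d x → d b ≤ d x → a ≡ b
  closer-neighbour-unique {x} {a} {b} x~a x~b da≤dx db≤dx with a Fin.≟ b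
  ... | yes a≡b = a≡b
  ... | no a≢b  = contradiction
    (neighbours-within⇒cycle x~a x~b a≢b (within-++
      (within-avoiding (λ { refl → ~-irrefl x~a }) da≤dx)
      (within-reverse (within-avoiding (λ { refl → ~-irrefl x~b }) db≤dx))))
    (proj₂ tree)

  first-step : ∀ {m} → Walk G m v c → Fin n
  first-step {v} []          = v
  first-step (_∷_ {v = w} _ _) = w

  first-step-closer : ∀ {m} (p : Walk G m v c) → v ≢ c → v ~ first-step p × d (first-step p) < m
  first-step-closer []      v≢c = contradiction refl v≢c
  first-step-closer (e ∷ p) _   = e , s≤s (dist≤ p)

  toward : Fin n → Fin n
  toward v = first-step (geodesic conn v c)

  toward-edge : v ≢ c → v ~ toward v
  toward-edge {v} v≢c = proj₁ (first-step-closer (geodesic conn v c) v≢c)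

  toward-dist : v ≢ c → d v ≡ suc (d (toward v))
  toward-dist {v} v≢c = ≤-antisym (dist-neighbour conn (toward-edge v≢c))
    (proj₂ (first-step-closer (geodesic conn v c) v≢c))

  farther-endpoint : u ~ v → d u ≤ d v → v ≢ c × toward v ≡ u
  farther-endpoint {u} {v} e du≤dv = v≢c ,
    closer-neighbour-unique (toward-edge v≢c) (~-sym e)
      (≤-trans (n≤1+n _) (≤-reflexive (sym (toward-dist v≢c)))) du≤dv
    where
    v≢c : v ≢ c
    v≢c refl with dist≡0⇒≡ conn (n≤0⇒n≡0 (≤-trans du≤dv (≤-reflexive dist-refl)))
    ... | refl = ~-irrefl e

  rooting : Rooting G
  rooting = record
    { root         = c
    ; parent       = toward
    ; depth        = d
    ; depth-root   = dist-refl
    ; depth-parent = toward-dist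
    ; parent-edge  = toward-edge
    ; edge-parent  = λ {u} {v} e → swap
      (Sum.map (farther-endpoint e) (farther-endpoint (~-sym e)) (≤-total (d u) (d v)))
    }

-- The median and the branches at it.

transmission : ∀ {n} (G : Graph (Fin n)) → Fin n → ℕ
transmission G v = ∑ (λ w → dist G w v)

-- At a vertex c of minimum transmission no branch holds more than half of the
-- vertices: moving from c to a neighbour v changes the transmission by
-- n − 2 s, where s is the size of the branch at v.
module Median {n : ℕ} {G : Graph (Fin n)} (tree : IsTree G) (c : Fin n)
  (minimal : ∀ v → transmission G c ≤ transmission G v) where

  open Graph G
  open TreeRooting tree c using (rooting)
  open Rooting rooting
  open Rooted rooting
  open Paths G

  branch-size : ∀ {v} → v ≢ c → parent v ≡ c → subtree-size v ≤ n ∸ subtree-size v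
  branch-size {v} v≢c pv≡c = +-cancelˡ-≤ (transmission G v) _ _ (begin
    transmission G v + subtree-size v
      ≡⟨ ∑-+ (λ w → dist G w v) (λ w → ⟦ w ⊑? v ⟧) ⟨
    ∑ (λ w → dist G w v + ⟦ w ⊑? v ⟧)                         ≤⟨ ∑-mono pointwise ⟩
    ∑ (λ w → dist G w c + ⟦ ¬? (w ⊑? v) ⟧)
      ≡⟨ ∑-+ (λ w → dist G w c) (λ w → ⟦ ¬? (w ⊑? v) ⟧) ⟩
    transmission G c + count (λ w → ¬? (w ⊑? v))
      ≡⟨ cong (transmission G c +_) (subtree-size-∁ v) ⟩
    transmission G c + (n ∸ subtree-size v)                   ≤⟨ +-monoˡ-≤ _ (minimal v) ⟩
    transmission G v + (n ∸ subtree-size v)                   ∎)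
    where
    open ≤-Reasoning
    pointwise : ∀ w → dist G w v + ⟦ w ⊑? v ⟧ ≤ dist G w c + ⟦ ¬? (w ⊑? v) ⟧
    pointwise w with w ⊑? v
    ... | no _  = ≤-trans (≤-reflexive (+-identityʳ _))
                    (dist-neighbourʳ connected (~-sym (subst (v ~_) pv≡c (parent-edge v≢c))))
    ... | yes p = ≤-trans (≤-reflexive (+-comm _ 1)) (≤-trans
                    (subst (λ x → dist G w v < dist G w x) pv≡c (⊑⇒closer v≢c p)) (m≤m+n _ 0))

  -- Branches shrink away from `c`, so the bound for the neighbours of `c` passes down to all
  -- vertices below them.
  subtree-size-small : ∀ v → v ≢ c → subtree-size v ≤ n ∸ subtree-size v
  subtree-size-small v = go (depth v) refl
    where
    go : ∀ i {v} → depth v ≡ i → v ≢ c → subtree-size v ≤ n ∸ subtree-size v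
    go zero    d≡ v≢c = contradiction (depth≡0⇒root d≡) v≢c
    go (suc i) {v} d≡ v≢c with parent v Fin.≟ c
    ... | yes pv≡c = branch-size v≢c pv≡c
    ... | no pv≢c  = ≤-trans grows (≤-trans (go i (parent-depth d≡) pv≢c) (∸-monoʳ-≤ n grows))
      where
      grows : subtree-size v ≤ subtree-size (parent v)
      grows = count-mono (_⊑? v) (_⊑? parent v) (⊑-parent v≢c)

  Mo-median : Mo G + 2 * total-depth ≤ #nonroot * n
  Mo-median = Mo-upper subtree-size-small

median : ∀ {n} (G : Graph (Fin (suc n))) → ∃[ c ] ∀ v → transmission G c ≤ transmission G v
median G = extremal (λ u v → transmission G u ≤ transmission G v) ≤-trans (λ u v → ≤-total _ _)

-- The numbered model of the extremal tree.

2*k%2≡0 : ∀ k → 2 * k % 2 ≡ 0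
2*k%2≡0 k = trans (cong (_% 2) (*-comm 2 k)) (m*n%n≡0 k 2)

suc-even⇒odd : ∀ m → suc m % 2 ≡ 0 → m % 2 ≡ 1
suc-even⇒odd (suc zero)    _ = refl
suc-even⇒odd (suc (suc m)) e = suc-even⇒odd m e

m∸n<m : ∀ {m} n .{{_ : NonZero n}} → m ≢ 0 → m ∸ n < m
m∸n<m {zero}  _       m≢0 = contradiction refl m≢0
m∸n<m {suc m} (suc n) _   = s≤s (m∸n≤m m n)

-- S_{n,r} with the vertices numbered level by level, n = m + 1: the centre is 0
-- and the vertex next to v ≠ 0 towards the centre is v ∸ r.
module Numbered (m r : ℕ) .{{_ : NonZero r}} where

  _↗_ : Fin (suc m) → Fin (suc m) → Set
  u ↗ v = toℕ u ≢ 0 × toℕ u ∸ r ≡ toℕ v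

  _↗?_ : ∀ u v → Dec (u ↗ v)
  u ↗? v = ¬? (toℕ u ≟ 0) ×-dec (toℕ u ∸ r ≟ toℕ v)

  graph : Graph (Fin (suc m))
  graph = record
    { _~_      = λ u v → u ↗ v ⊎ v ↗ u
    ; _~?_     = λ u v → (u ↗? v) ⊎-dec (v ↗? u)
    ; ~-sym    = swap
    ; ~-irrefl = [ irrefl , irrefl ]′
    }
    where
    irrefl : ∀ {u} → ¬ u ↗ u
    irrefl (u≢0 , eq) = <⇒≢ (m∸n<m r u≢0) eq

  predecessor : Fin (suc m) → Fin (suc m)
  predecessor u = fromℕ< (≤-<-trans (m∸n≤m (toℕ u) r) (toℕ<n u))

  toℕ-predecessor : ∀ u → toℕ (predecessor u) ≡ toℕ u ∸ r
  toℕ-predecessor u = toℕ-fromℕ< _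

  -- The vertices `1` to `r` form level 1, the next `r` level 2, and so on; subtracting `r` drops
  -- one level, and truncation sends all of level 1 to the centre.
  level-of : ℕ → ℕ
  level-of zero    = 0
  level-of (suc u) = suc (u / r)

  level-of-suc : ∀ u → level-of (suc u) ≡ suc (level-of (suc u ∸ r))
  level-of-suc u with <-≤-connex u r
  ... | inj₁ u<r = cong suc (trans (m<n⇒m/n≡0 u<r) (sym (cong level-of (m≤n⇒m∸n≡0 u<r))))
  ... | inj₂ r≤u = cong suc (trans (m/n≡1+[m∸n]/n r≤u) (sym (cong level-of (+-∸-assoc 1 r≤u))))

  ≢zero⇒toℕ≢0 : ∀ {u : Fin (suc m)} → u ≢ zero → toℕ u ≢ 0
  ≢zero⇒toℕ≢0 u≢0 eq = u≢0 (toℕ-injective eq)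

  rooting : Rooting graph
  rooting = record
    { root         = zero
    ; parent       = predecessor
    ; depth        = level-of ∘ toℕ
    ; depth-root   = refl
    ; depth-parent = λ {v} → depth-predecessor v
    ; parent-edge  = λ {v} v≢0 → inj₁ (≢zero⇒toℕ≢0 v≢0 , sym (toℕ-predecessor v))
    ; edge-parent  = Sum.map up↗ up↗
    }
    where
    depth-predecessor : ∀ v → v ≢ zero → level-of (toℕ v) ≡ suc (level-of (toℕ (predecessor v)))
    depth-predecessor zero    v≢0 = contradiction refl v≢0
    depth-predecessor (suc v) v≢0 =
      trans (level-of-suc (toℕ v)) (cong (suc ∘ level-of) (sym (toℕ-predecessor (suc v))))
    up↗ : ∀ {u v} → u ↗ v → u ≢ zero × predecessor u ≡ v
    up↗ {u} (u≢0 , eq) = (λ { refl → u≢0 refl }) , toℕ-injective (trans (toℕ-predecessor u) eq)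

  open Rooted rooting
  open Levels rooting

  isTree : IsTree graph
  isTree = connected , acyclic

  i≤u/r⇒r*i≤u : ∀ {u i} → i ≤ u / r → r * i ≤ u
  i≤u/r⇒r*i≤u {u} {i} i≤ = begin
    r * i         ≤⟨ *-monoʳ-≤ r i≤ ⟩
    r * (u / r)   ≡⟨ *-comm r _ ⟩
    u / r * r     ≤⟨ m/n*n≤m u r ⟩
    u             ∎
    where open ≤-Reasoning

  r*i≤u⇒i≤u/r : ∀ {u i} → r * i ≤ u → i ≤ u / r
  r*i≤u⇒i≤u/r {u} {i} r*i≤u = begin
    i             ≡⟨ m*n/n≡m i r ⟨
    i * r / r     ≡⟨ cong (_/ r) (*-comm i r) ⟩
    r * i / r     ≤⟨ /-monoˡ-≤ r r*i≤u ⟩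
    u / r         ∎
    where open ≤-Reasoning

  -- The first `i` levels below the centre use up the first `r * i` non-central vertices, or all `m`
  -- of them; truncation covers both cases.
  deep≡ : ∀ i → deep (suc i) ≡ m ∸ r * i
  deep≡ i = trans (∑-cong {m} λ u → ⟦⟧-cong (suc i ≤? suc (toℕ u / r)) (r * i ≤? toℕ u)
    (i≤u/r⇒r*i≤u ∘ s≤s⁻¹) (s≤s ∘ r*i≤u⇒i≤u/r)) (count-≥ m (r * i))

  ↑-suc : ∀ {u v} → u ↑ suc v → toℕ u ≡ suc (toℕ v) + r
  ↑-suc {u} {v} (_ , eq) = trans (sym (m∸n+n≡m r≤u)) (cong (_+ r) u∸r)
    where
    u∸r : toℕ u ∸ r ≡ suc (toℕ v)
    u∸r = trans (sym (toℕ-predecessor u)) (cong toℕ eq)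
    r≤u : r ≤ toℕ u
    r≤u = <⇒≤ (m∸n≢0⇒n<m λ u∸r≡0 → contradiction (trans (sym u∸r) u∸r≡0) λ ())

  children-suc : ∀ v → toℕ (suc {m} v) + r < suc m → children (suc v) ≡ 1
  children-suc v lt = trans (count-cong (_↑? suc v) (w Fin.≟_) to from) (count-singleton w)
    where
    w = fromℕ< lt
    toℕ-w : toℕ w ≡ suc (toℕ v) + r
    toℕ-w = toℕ-fromℕ< lt
    to : ∀ {u} → u ↑ suc v → w ≡ u
    to p = toℕ-injective (trans toℕ-w (sym (↑-suc p)))
    from : ∀ {u} → w ≡ u → u ↑ suc v
    from refl = (λ w≡0 → contradiction (trans (sym toℕ-w) (cong toℕ w≡0)) λ ()) ,
      toℕ-injective (trans (toℕ-predecessor w) (trans (cong (_∸ r) toℕ-w) (m+n∸n≡m (suc (toℕ v)) r)))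

  children-suc-none : ∀ v → suc m ≤ toℕ (suc {m} v) + r → children (suc v) ≡ 0
  children-suc-none v m<v+r = n≤0⇒n≡0 (≮⇒≥ λ 0<c → let u , p = count-witness (_↑? suc v) 0<c in
    <⇒≱ (toℕ<n u) (≤-trans m<v+r (≤-reflexive (sym (↑-suc p)))))

  children-zero : children zero ≡ count {m} (λ u → toℕ u <? r)
  children-zero = begin
    children zero
      ≡⟨ cong (_+ count {m} (λ u → suc u ↑? zero)) (⟦⟧-false (zero ↑? zero) λ p → proj₁ p refl) ⟩
    count {m} (λ u → suc u ↑? zero)
      ≡⟨ count-cong {m} (λ u → suc u ↑? zero) (λ u → toℕ u <? r) to from ⟩
    count {m} (λ u → toℕ u <? r)                        ∎
    where
    open ≡-Reasoning
    to : ∀ {u} → suc u ↑ zero → toℕ u < r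
    to {u} (_ , p) = m∸n≡0⇒m≤n (trans (sym (toℕ-predecessor (suc u))) (cong toℕ p))
    from : ∀ {u} → toℕ u < r → suc u ↑ zero
    from {u} lt = (λ ()) , toℕ-injective (trans (toℕ-predecessor (suc u)) (m≤n⇒m∸n≡0 lt))

  module _ (r≤1+m : r ≤ suc m) (r-even : r % 2 ≡ 0) where

    -- If `v + r` is still a vertex, then `v` has even degree: a non-central `v` has its parent and
    -- the one child `v + r`, and the centre has all of its `r` children.
    odd⇒outer : ∀ {v} → OddVertex graph v → suc m ∸ r ≤ toℕ v
    odd⇒outer {v} odd = ≮⇒≥ λ inner → contradiction (trans (sym odd) (even v (m<n∸o⇒m+o<n inner))) λ ()
      where
      m<n∸o⇒m+o<n : ∀ {a} → a < suc m ∸ r → a + r < suc m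
      m<n∸o⇒m+o<n a< = ≤-trans (+-monoˡ-≤ r a<) (≤-reflexive (m∸n+n≡m r≤1+m))
      even : ∀ v → toℕ v + r < suc m → degree graph v % 2 ≡ 0
      even zero    lt = trans (cong (_% 2)
        (trans (degree≡ zero) (trans children-zero (count-< r (s≤s⁻¹ lt))))) r-even
      even (suc v) lt = cong (_% 2) (trans (degree≡ (suc v)) (cong suc (children-suc v lt)))

    -- A non-central outer vertex ends its leg. The centre is outer only for `r = suc m`, the star
    -- whose vertices are all odd: its degree `m` is odd because `r` is even.
    outer⇒odd : ∀ {v} → suc m ∸ r ≤ toℕ v → OddVertex graph v
    outer⇒odd {v} outer = odd v (≤-trans (m≤n+m∸n (suc m) r)
      (≤-trans (+-monoʳ-≤ r outer) (≤-reflexive (+-comm r (toℕ v)))))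
      where
      odd : ∀ v → suc m ≤ toℕ v + r → degree graph v % 2 ≡ 1
      odd zero m<r = trans (cong (_% 2) (trans (degree≡ zero) (trans children-zero all)))
        (suc-even⇒odd m (trans (cong (_% 2) (≤-antisym m<r r≤1+m)) r-even))
        where
        all : count {m} (λ u → toℕ u <? r) ≡ m
        all = trans (∑-cong {m} λ u → ⟦⟧-true (toℕ u <? r) (≤-trans (s≤s (<⇒≤ (toℕ<n u))) m<r))
          (trans (∑-const m 1) (*-identityʳ m))
      odd (suc v) m<v+r = cong (_% 2) (trans (degree≡ (suc v)) (cong suc (children-suc-none v m<v+r)))

    #odd≡r : #odd graph ≡ r
    #odd≡r = trans (count-cong (oddVertex? graph) (λ v → suc m ∸ r ≤? toℕ v) odd⇒outer outer⇒odd)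
      (trans (count-≥ (suc m) (suc m ∸ r)) (m∸[m∸n]≡n r≤1+m))

-- Sorting the branches, and trees with extremal level sizes.

≅-trans : {U V W : Set} {G : Graph U} {H : Graph V} {K : Graph W} → G ≅ H → H ≅ K → G ≅ K
≅-trans G≅H H≅K = record
  { bijection = H≅K.bijection Composition.⤖-∘ G≅H.bijection
  ; adjacency = λ u v → H≅K.adjacency _ _ Composition.⇔-∘ G≅H.adjacency u v
  }
  where
  module G≅H = _≅_ G≅H
  module H≅K = _≅_ H≅K

module Ranking {n : ℕ} {P : Pred (Fin n) 0ℓ} (P? : Decidable P) (key : Fin n → ℕ) where

  private variable
    x y z : Fin n

  -- Larger keys come first and vertex numbers break ties, so the order is total and ranks are
  -- distinct.
  _≺_ : Fin n → Fin n → Set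
  y ≺ x = key x < key y ⊎ (key x ≡ key y × toℕ y < toℕ x)

  _≺?_ : ∀ y x → Dec (y ≺ x)
  y ≺? x = (key x <? key y) ⊎-dec ((key x ≟ key y) ×-dec (toℕ y <? toℕ x))

  ≺⇒≤ : y ≺ x → key x ≤ key y
  ≺⇒≤ = [ <⇒≤ , ≤-reflexive ∘ proj₁ ]′

  ≺-irrefl : ¬ x ≺ x
  ≺-irrefl = [ <-irrefl refl , <-irrefl refl ∘ proj₂ ]′

  ≺-trans : z ≺ y → y ≺ x → z ≺ x
  ≺-trans (inj₁ p)        q               = inj₁ (≤-<-trans (≺⇒≤ q) p)
  ≺-trans (inj₂ (e , _))  (inj₁ q)        = inj₁ (≤-trans q (≤-reflexive e))
  ≺-trans (inj₂ (e , p))  (inj₂ (e′ , q)) = inj₂ (trans e′ e , <-trans p q)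

  ≺-total : x ≢ y → x ≺ y ⊎ y ≺ x
  ≺-total {x} {y} x≢y with <-cmp (key x) (key y)
  ... | tri< lt _ _ = inj₂ (inj₁ lt)
  ... | tri> _ _ gt = inj₁ (inj₁ gt)
  ... | tri≈ _ eq _ with <-cmp (toℕ x) (toℕ y)
  ...   | tri< lt _ _ = inj₁ (inj₂ (sym eq , lt))
  ...   | tri> _ _ gt = inj₂ (inj₂ (eq , gt))
  ...   | tri≈ _ e _  = contradiction (toℕ-injective e) x≢y

  rank : Fin n → ℕ
  rank x = count (λ y → P? y ×-dec (y ≺? x))

  rank-mono : P y → y ≺ x → rank y < rank x
  rank-mono {y} {x} py y≺x = count-strict (λ z → P? z ×-dec (z ≺? y)) (λ z → P? z ×-dec (z ≺? x))
    (λ (pz , z≺y) → pz , ≺-trans z≺y y≺x) y (py , y≺x) (≺-irrefl ∘ proj₂)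

  rank-injective : P x → P y → rank x ≡ rank y → x ≡ y
  rank-injective {x} {y} px py eq with x Fin.≟ y
  ... | yes x≡y = x≡y
  ... | no x≢y with ≺-total x≢y
  ...   | inj₁ x≺y = contradiction eq (<⇒≢ (rank-mono px x≺y))
  ...   | inj₂ y≺x = contradiction (sym eq) (<⇒≢ (rank-mono py y≺x))

  rank< : P x → rank x < count (λ y → P? y ×-dec (key x ≤? key y))
  rank< {x} px = count-strict (λ y → P? y ×-dec (y ≺? x)) (λ y → P? y ×-dec (key x ≤? key y))
    (λ (py , y≺x) → py , ≺⇒≤ y≺x) x (px , ≤-refl) (≺-irrefl ∘ proj₂)

module Tight {m : ℕ} {G : Graph (Fin (suc m))} (R : Rooting G) (r : ℕ) .{{_ : NonZero r}}
  (1≤m : 1 ≤ m) (#leaf≤r : Levels.#leaf R ≤ r)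
  (deep≡ : ∀ i → i < suc m → Levels.deep R (suc i) ≡ m ∸ r * i) where

  open Graph G
  open Rooting R
  open Rooted R
  open Levels R
  open Numbered m r using (graph; _↗_)

  private variable
    v w x : Fin (suc m)

  #nonroot≡m : #nonroot ≡ m
  #nonroot≡m = suc-injective suc-#nonroot

  -- For `r ≤ m` the bound on the leaves suffices. For `m ≤ r` truncation makes `deep 2` zero, and
  -- there are at most `m` leaves because all of them are non-root vertices.
  tight : #leaf + deep 2 ≤ deep 1
  tight = begin
    #leaf + deep 2
      ≡⟨ cong (#leaf +_) (trans (deep≡ 1 (s≤s 1≤m)) (cong (m ∸_) (*-identityʳ r))) ⟩
    #leaf + (m ∸ r)        ≤⟨ go (≤-total r m) ⟩
    m                      ≡⟨ trans deep-1 #nonroot≡m ⟨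
    deep 1                 ∎
    where
    open ≤-Reasoning
    go : r ≤ m ⊎ m ≤ r → #leaf + (m ∸ r) ≤ m
    go (inj₁ r≤m) = ≤-trans (+-monoˡ-≤ (m ∸ r) #leaf≤r) (≤-reflexive (m+[n∸m]≡n r≤m))
    go (inj₂ m≤r) = begin
      #leaf + (m ∸ r)      ≡⟨ trans (cong (#leaf +_) (m≤n⇒m∸n≡0 m≤r)) (+-identityʳ _) ⟩
      #leaf                ≤⟨ count-mono leaf? nonroot? proj₁ ⟩
      #nonroot             ≡⟨ #nonroot≡m ⟩
      m                    ∎

  parent-injective : ∀ {i} → depth v ≡ 2 + i → depth w ≡ 2 + i → parent v ≡ parent w → v ≡ w
  parent-injective {v} {w} dv dw eq = unique-child tight (suc-depth⇒nonroot (parent-depth dv))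
    (suc-depth⇒nonroot dv , refl) (suc-depth⇒nonroot dw , sym eq)

  ancestor : ℕ → Fin (suc m) → Fin (suc m)
  ancestor zero    v = v
  ancestor (suc k) v = ancestor k (parent v)

  ancestor-+ : ∀ k l v → ancestor l (ancestor k v) ≡ ancestor (k + l) v
  ancestor-+ zero    l v = refl
  ancestor-+ (suc k) l v = ancestor-+ k l (parent v)

  depth-ancestor : ∀ k {d} → depth v ≡ k + suc d → depth (ancestor k v) ≡ suc d
  depth-ancestor zero    dv = dv
  depth-ancestor (suc k) dv = depth-ancestor k (parent-depth dv)

  ancestor-injective : ∀ k → depth v ≡ suc k → depth w ≡ suc k → ancestor k v ≡ ancestor k w → v ≡ w
  ancestor-injective zero    _  _  eq = eq
  ancestor-injective (suc k) dv dw eq =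
    parent-injective dv dw (ancestor-injective k (parent-depth dv) (parent-depth dw) eq)

  -- The vertex of level 1 above `v`, which names the branch. The root becomes its own branch,
  -- harmlessly, since its depth adds 0 in `depth-in`.
  branch : Fin (suc m) → Fin (suc m)
  branch v = ancestor (pred (depth v)) v

  branch≡ : ∀ {i} → depth v ≡ suc i → branch v ≡ ancestor i v
  branch≡ {v} dv = cong (λ d → ancestor (pred d) v) dv

  depth-branch : ∀ {i} → depth v ≡ suc i → depth (ancestor i v) ≡ 1
  depth-branch {i = i} dv = depth-ancestor i (trans dv (sym (+-comm i 1)))

  -- Vanishes outside the branch of `x`, so a maximum over all vertices yields the height of that
  -- branch.
  depth-in : Fin (suc m) → Fin (suc m) → ℕ
  depth-in x w = ⟦ branch w Fin.≟ x ⟧ * depth w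

  deepest : ∀ x → ∃[ w ] ∀ v → depth-in x v ≤ depth-in x w
  deepest x = extremal (λ w v → depth-in x v ≤ depth-in x w) (λ p q → ≤-trans q p) (λ w v → ≤-total _ _)

  height : Fin (suc m) → ℕ
  height x = depth-in x (proj₁ (deepest x))

  depth-in-branch : branch w ≡ x → depth-in x w ≡ depth w
  depth-in-branch {w} {x} eq = trans (cong (_* depth w) (⟦⟧-true (branch w Fin.≟ x) eq)) (*-identityˡ _)

  depth≤height : branch w ≡ x → depth w ≤ height x
  depth≤height {w} {x} eq = ≤-trans (≤-reflexive (sym (depth-in-branch eq))) (proj₂ (deepest x) w)

  -- `x` itself has depth 1 in its branch, so the maximum is positive and is not taken outside.
  height-attained : depth x ≡ 1 → ∃[ w ] branch w ≡ x × depth w ≡ height x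
  height-attained {x} dx = go (branch low Fin.≟ x)
    where
    low = proj₁ (deepest x)
    go : Dec (branch low ≡ x) → ∃[ w ] branch w ≡ x × depth w ≡ height x
    go (yes eq) = low , eq , sym (depth-in-branch eq)
    go (no ne)  = contradiction (≤-trans (≤-reflexive (sym dx)) (depth≤height (branch≡ dx)))
      (<⇒≱ (s≤s (≤-reflexive (cong (_* depth low) (⟦⟧-false (branch low Fin.≟ x) ne)))))

  top? : Decidable (λ v → depth v ≡ 1)
  top? v = depth v ≟ 1

  -- Taller branches come first, as do the longer legs in the spider.
  open Ranking top? height

  -- A branch at least as tall as that of `v` has a vertex on the level of `v`, so this level has
  -- room for all branches ranked up to that one. Hence the ranks present on a level form an initial
  -- segment, as in the model.
  rank<level : ∀ {i} → depth v ≡ suc i → rank (ancestor i v) < level (suc i)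
  rank<level {v} {i} dv = ≤-trans (rank< (depth-branch dv))
    (count-cover (λ y → top? y ×-dec (height (ancestor i v) ≤? height y)) (λ w → depth w ≟ suc i)
      (ancestor i) (λ y (dy , tall) → descend dy
        (≤-trans (≤-reflexive (sym dv)) (≤-trans (depth≤height (branch≡ dv)) tall))))
    where
    descend : ∀ {y} → depth y ≡ 1 → suc i ≤ height y → ∃[ w ] depth w ≡ suc i × ancestor i w ≡ y
    descend {y} dy i<h with height-attained dy
    ... | w , bw , dw = ancestor e w , depth-ancestor e dw′ ,
      trans (ancestor-+ e i w) (trans (sym (branch≡ (trans dw′ (+-suc e i)))) bw)
      where
      -- The length of the climb from a deepest vertex of the branch up to level `suc i`.
      e = depth w ∸ suc i
      dw′ : depth w ≡ e + suc i
      dw′ = sym (m∸n+n≡m (≤-trans i<h (≤-reflexive (sym dw))))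

  rank<r : depth x ≡ 1 → rank x < r
  rank<r dx = ≤-trans (rank<level dx) (≤-trans (level≤#leaf 0) #leaf≤r)

  -- The intended number in `Numbered.graph`: one for the centre, `r` for each of the `i` levels in
  -- between, then the rank of the branch.
  number : ℕ → Fin (suc m) → ℕ
  number zero    v = 0
  number (suc i) v = suc (rank (ancestor i v) + r * i)

  number< : ∀ d {v} → depth v ≡ d → number d v < suc m
  number< zero    _  = z<s
  number< (suc i) {v} dv = s≤s (begin-strict
    rank (ancestor i v) + r * i     <⟨ +-monoˡ-< (r * i) rank<deep ⟩
    m ∸ r * i + r * i               ≡⟨ m∸n+n≡m r*i≤m ⟩
    m                               ∎)
    where
    open ≤-Reasoning
    rank<deep : rank (ancestor i v) < m ∸ r * i
    rank<deep = begin-strict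
      rank (ancestor i v)           <⟨ rank<level dv ⟩
      level (suc i)                 ≤⟨ m≤m+n _ _ ⟩
      level (suc i) + deep (2 + i)  ≡⟨ deep-split (suc i) ⟨
      deep (suc i)
        ≡⟨ deep≡ i (<-trans (n<1+n i) (≤-trans (≤-reflexive (cong suc (sym dv))) (depth<n v))) ⟩
      m ∸ r * i                     ∎
    -- `m ∸ r * i` exceeds a rank, so it is positive and was not truncated.
    r*i≤m : r * i ≤ m
    r*i≤m = <⇒≤ (m∸n≢0⇒n<m (>⇒≢ (≤-<-trans z≤n rank<deep)))

  remainder-unique : ∀ {a b i j} → a < r → b < r → a + r * i ≡ b + r * j → a ≡ b × i ≡ j
  remainder-unique {a} {b} {i} {j} a<r b<r eq =
    a≡b , *-cancelˡ-≡ i j r (+-cancelˡ-≡ a _ _ (trans eq (cong (_+ r * j) (sym a≡b))))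
    where
    reduce : ∀ a i → a < r → (a + r * i) % r ≡ a
    reduce a i a<r = trans (cong (λ k → (a + k) % r) (*-comm r i))
      (trans ([m+kn]%n≡m%n a i r) (m<n⇒m%n≡m a<r))
    a≡b : a ≡ b
    a≡b = trans (sym (reduce a i a<r)) (trans (cong (_% r) eq) (reduce b j b<r))

  same-level : ∀ {i j v w} → depth v ≡ suc i → depth w ≡ suc j →
    rank (ancestor i v) ≡ rank (ancestor j w) × i ≡ j → v ≡ w
  same-level {i} dv dw (ranks≡ , refl) =
    ancestor-injective i dv dw (rank-injective (depth-branch dv) (depth-branch dw) ranks≡)

  number-injective : ∀ d e {v w} → depth v ≡ d → depth w ≡ e → number d v ≡ number e w → v ≡ w
  number-injective zero    zero    dv dw _  = trans (depth≡0⇒root dv) (sym (depth≡0⇒root dw))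
  number-injective (suc i) (suc j) dv dw eq = same-level dv dw
    (remainder-unique (rank<r (depth-branch dv)) (rank<r (depth-branch dw)) (suc-injective eq))

  -- The parent lies in the same branch one level up, so the number falls by `r`. On level 1 the
  -- number is at most `r`, and truncation lands on the centre.
  number-parent : ∀ d {v} → depth v ≡ suc d → number (suc d) v ∸ r ≡ number d (parent v)
  number-parent zero    {v} dv = m≤n⇒m∸n≡0
    (≤-trans (≤-reflexive (cong suc (trans (cong (rank v +_) (*-zeroʳ r)) (+-identityʳ _))))
      (rank<r dv))
  number-parent (suc d) {v} dv = begin
    suc (a + r * suc d) ∸ r        ≡⟨ cong (λ k → suc k ∸ r) (rearrange a r d) ⟩
    suc (a + r * d) + r ∸ r        ≡⟨ m+n∸n≡m (suc (a + r * d)) r ⟩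
    suc (a + r * d)                ∎
    where
    open ≡-Reasoning
    a = rank (ancestor d (parent v))
    rearrange : ∀ a r d → a + r * suc d ≡ a + r * d + r
    rearrange = solve-∀

  φ : Fin (suc m) → Fin (suc m)
  φ v = fromℕ< (number< (depth v) {v} refl)

  toℕ-φ : ∀ {d} → depth v ≡ d → toℕ (φ v) ≡ number d v
  toℕ-φ refl = toℕ-fromℕ< _

  φ-injective : Injective _≡_ _≡_ φ
  φ-injective {v} {w} eq = number-injective (depth v) (depth w) refl refl
    (trans (sym (toℕ-φ refl)) (trans (cong toℕ eq) (toℕ-φ refl)))

  φ-parent : v ≢ root → φ v ↗ φ (parent v)
  φ-parent {v} nr = (λ eq → contradiction (trans (sym (toℕ-φ (depth-parent nr))) eq) λ ()) ,
    trans (cong (_∸ r) (toℕ-φ (depth-parent nr)))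
      (trans (number-parent (depth (parent v)) (depth-parent nr)) (sym (toℕ-φ refl)))

  φ-up : ∀ {u v} → u ↑ v → φ u ↗ φ v
  φ-up (nr , refl) = φ-parent nr

  -- In the model `φ u` has a single neighbour towards the centre, and `φ (parent u)` is one.
  φ-up⁻ : ∀ {u v} → φ u ↗ φ v → u ↑ v
  φ-up⁻ {u} {v} (φu≢0 , eq) = nr , φ-injective (toℕ-injective (trans (sym (proj₂ (φ-parent nr))) eq))
    where
    nr : u ≢ root
    nr refl = φu≢0 (toℕ-φ depth-root)

  ≅-numbered : G ≅ graph
  ≅-numbered = record
    { bijection = injective⇒⤖ φ-injective
    ; adjacency = λ u v → mk⇔ (Sum.map φ-up φ-up ∘ edge-parent)
        [ ↑⇒~ ∘ φ-up⁻ , ~-sym ∘ ↑⇒~ ∘ φ-up⁻ ]′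
    }

-- The numbered model as star and as spider.

module _ {r : ℕ} {ℓ : Fin r → ℕ} where

  private variable
    i i′ : Fin r

  leg-cong : ∀ {j : Fin (ℓ i)} {j′ : Fin (ℓ i′)} → i ≡ i′ → toℕ j ≡ toℕ j′ → leg {ℓ = ℓ} i j ≡ leg i′ j′
  leg-cong {i} refl eq = cong (leg i) (toℕ-injective eq)

  leg-injective : ∀ {j : Fin (ℓ i)} {j′ : Fin (ℓ i′)} → leg {ℓ = ℓ} i j ≡ leg i′ j′ → i ≡ i′ × toℕ j
    ≡ toℕ j′
  leg-injective refl = refl , refl

module NumberedShapes (m r : ℕ) .{{_ : NonZero r}} where

  open Numbered m r

  numbered≅star : m ≤ r → graph ≅ star (suc m)
  numbered≅star m≤r = record
    { bijection = Identity.⤖-id _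
    ; adjacency = λ u v → mk⇔ [ inj₂ ∘ to {u} {v} , inj₁ ∘ to {v} {u} ]′ [ inj₂ ∘ from , inj₁ ∘ from ]′
    }
    where
    u∸r≡0 : ∀ (u : Fin (suc m)) → toℕ u ∸ r ≡ 0
    u∸r≡0 u = m≤n⇒m∸n≡0 (≤-trans (s≤s⁻¹ (toℕ<n u)) m≤r)
    to : ∀ {u v} → u ↗ v → toℕ v ≡ 0 × toℕ u ≢ 0
    to {u} (u≢0 , eq) = trans (sym eq) (u∸r≡0 u) , u≢0
    from : ∀ {u v : Fin (suc m)} → toℕ u ≡ 0 × toℕ v ≢ 0 → v ↗ u
    from {u} {v} (u≡0 , v≢0) = v≢0 , trans (u∸r≡0 v) (sym u≡0)

  private
    q = m / r
    t = m ∸ r * q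
    ℓ = balanced (suc m) r

    r*q≤m : r * q ≤ m
    r*q≤m = i≤u/r⇒r*i≤u ≤-refl

    t+r*q≡m : t + r * q ≡ m
    t+r*q≡m = m∸n+n≡m r*q≤m

  long-leg : ∀ i → toℕ i < t → ℓ i ≡ suc q
  long-leg i i<t = trans (cong (λ b → if b then q + 1 else q) (dec-true (toℕ i <? t) i<t)) (+-comm q 1)

  short-leg : ∀ i → t ≤ toℕ i → ℓ i ≡ q
  short-leg i t≤i = cong (λ b → if b then q + 1 else q) (dec-false (toℕ i <? t) (≤⇒≯ t≤i))

  -- Vertex `leg i j` is to have the number `1 + i + r * j`. As `m = t + r * q`, the rows `j < q`
  -- are complete, and the row `j = q` holds only the legs `i < t`, the long ones.
  on-leg⇒<m : ∀ i {j} → j < ℓ i → toℕ i + r * j < m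
  on-leg⇒<m i {j} j<ℓ with <-≤-connex (toℕ i) t
  ... | inj₁ i<t = <-≤-trans (+-mono-<-≤ i<t
    (*-monoʳ-≤ r (s≤s⁻¹ (≤-trans j<ℓ (≤-reflexive (long-leg i i<t))))))
    (≤-reflexive t+r*q≡m)
  ... | inj₂ t≤i = begin-strict
    toℕ i + r * j   <⟨ +-monoˡ-< (r * j) (toℕ<n i) ⟩
    r + r * j       ≡⟨ *-suc r j ⟨
    r * suc j       ≤⟨ *-monoʳ-≤ r (≤-trans j<ℓ (≤-reflexive (short-leg i t≤i))) ⟩
    r * q           ≤⟨ r*q≤m ⟩
    m               ∎
    where open ≤-Reasoning

  <m⇒on-leg : ∀ i {j} → toℕ i + r * j < m → j < ℓ i
  <m⇒on-leg i {j} lt with <-≤-connex (toℕ i) t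
  ... | inj₁ i<t = ≤-trans (s≤s (r*i≤u⇒i≤u/r (≤-trans (m≤n+m (r * j) (toℕ i)) (<⇒≤ lt))))
    (≤-reflexive (sym (long-leg i i<t)))
  ... | inj₂ t≤i = ≤-trans (*-cancelˡ-< r j q (+-cancelˡ-< t _ _
    (≤-<-trans (+-monoˡ-≤ (r * j) t≤i) (<-≤-trans lt (≤-reflexive (sym t+r*q≡m))))))
    (≤-reflexive (sym (short-leg i t≤i)))

  leg-of : ℕ → Fin r
  leg-of u = fromℕ< (m%n<n u r)

  toℕ-leg-of : ∀ u → toℕ (leg-of u) ≡ u % r
  toℕ-leg-of u = toℕ-fromℕ< _

  divMod≡ : ∀ u → toℕ (leg-of u) + r * (u / r) ≡ u
  divMod≡ u = trans (cong₂ _+_ (toℕ-leg-of u) (*-comm r (u / r))) (sym (m≡m%n+[m/n]*n u r))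

  position : (u : Fin m) → Fin (ℓ (leg-of (toℕ u)))
  position u = fromℕ< (<m⇒on-leg (leg-of (toℕ u))
    (≤-trans (s≤s (≤-reflexive (divMod≡ (toℕ u)))) (toℕ<n u)))

  toℕ-position : ∀ u → toℕ (position u) ≡ toℕ u / r
  toℕ-position u = toℕ-fromℕ< _

  place : Fin (suc m) → SpiderVertex ℓ
  place zero    = centre
  place (suc u) = leg (leg-of (toℕ u)) (position u)

  place-injective : Injective _≡_ _≡_ place
  place-injective {zero}  {zero}  _  = refl
  place-injective {suc u} {suc v} eq with leg-injective eq
  ... | legs≡ , positions≡ = cong suc (toℕ-injective (begin
    toℕ u                                        ≡⟨ divMod≡ (toℕ u) ⟨
    toℕ (leg-of (toℕ u)) + r * (toℕ u / r)
      ≡⟨ cong₂ (λ a b → toℕ a + r * b) legs≡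
        (trans (sym (toℕ-position u)) (trans positions≡ (toℕ-position v))) ⟩
    toℕ (leg-of (toℕ v)) + r * (toℕ v / r)       ≡⟨ divMod≡ (toℕ v) ⟩
    toℕ v                                        ∎))
    where open ≡-Reasoning

  %-at : ∀ (i : Fin r) j → (toℕ i + r * j) % r ≡ toℕ i
  %-at i j = trans (cong (λ k → (toℕ i + k) % r) (*-comm r j))
    (trans ([m+kn]%n≡m%n (toℕ i) j r) (m<n⇒m%n≡m (toℕ<n i)))

  /-at : ∀ (i : Fin r) j → (toℕ i + r * j) / r ≡ j
  /-at i j = *-cancelˡ-≡ _ _ r (+-cancelˡ-≡ (toℕ i) _ _
    (trans (cong (_+ r * ((toℕ i + r * j) / r)) (sym (trans (toℕ-leg-of _) (%-at i j))))
      (divMod≡ (toℕ i + r * j))))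

  place-surjective : Surjective _≡_ _≡_ place
  place-surjective centre    = zero , λ { refl → refl }
  place-surjective (leg i j) = suc u , λ { refl → leg-cong
    (toℕ-injective (trans (toℕ-leg-of (toℕ u)) (trans (cong (_% r) toℕ-u) (%-at i (toℕ j)))))
    (trans (toℕ-position u) (trans (cong (_/ r) toℕ-u) (/-at i (toℕ j)))) }
    where
    u = fromℕ< (on-leg⇒<m i (toℕ<n j))
    toℕ-u : toℕ u ≡ toℕ i + r * toℕ j
    toℕ-u = toℕ-fromℕ< _

  module _ (u v : Fin m) where

    -- Subtracting `r` keeps the remainder, which is the leg, and lowers the quotient, which is the
    -- position, by one.
    same-leg : suc u ↗ suc v → leg-of (toℕ u) ≡ leg-of (toℕ v) × suc (toℕ (position v)) ≡ toℕ
      (position u)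
    same-leg (_ , eq) =
      toℕ-injective (trans (toℕ-leg-of (toℕ u))
        (trans (cong (_% r) u≡v+r) (trans ([m+n]%n≡m%n (toℕ v) r) (sym (toℕ-leg-of (toℕ v)))))) ,
      sym (trans (toℕ-position u) (trans (cong (_/ r) u≡v+r) (trans (m/n≡1+[m∸n]/n (m≤n+m r (toℕ v)))
        (cong suc (trans (cong (_/ r) (m+n∸n≡m (toℕ v) r)) (sym (toℕ-position v)))))))
      where
      r≤1+u : r ≤ suc (toℕ u)
      r≤1+u = <⇒≤ (m∸n≢0⇒n<m λ z → contradiction (trans (sym eq) z) λ ())
      u≡v+r : toℕ u ≡ toℕ v + r
      u≡v+r = suc-injective (trans (sym (m∸n+n≡m r≤1+u)) (cong (_+ r) eq))

    same-leg⁻ : leg-of (toℕ u) ≡ leg-of (toℕ v) → suc (toℕ (position v)) ≡ toℕ (position u) → suc u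
      ↗ suc v
    same-leg⁻ legs≡ positions≡ = (λ ()) , trans (cong (λ k → suc k ∸ r) u≡v+r) (m+n∸n≡m (suc (toℕ v)) r)
      where
      open ≡-Reasoning
      rearrange : ∀ a r d → a + r * suc d ≡ a + r * d + r
      rearrange = solve-∀
      u≡v+r : toℕ u ≡ toℕ v + r
      u≡v+r = begin
        toℕ u                                          ≡⟨ divMod≡ (toℕ u) ⟨
        toℕ (leg-of (toℕ u)) + r * (toℕ u / r)
          ≡⟨ cong₂ (λ a b → toℕ a + r * b) legs≡
               (trans (sym (toℕ-position u)) (trans (sym positions≡) (cong suc (toℕ-position v)))) ⟩
        toℕ (leg-of (toℕ v)) + r * suc (toℕ v / r)
          ≡⟨ rearrange (toℕ (leg-of (toℕ v))) r (toℕ v / r) ⟩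
        toℕ (leg-of (toℕ v)) + r * (toℕ v / r) + r     ≡⟨ cong (_+ r) (divMod≡ (toℕ v)) ⟩
        toℕ v + r                                      ∎

  next-to-centre : ∀ {u} → suc u ↗ zero → toℕ (position u) ≡ 0
  next-to-centre {u} (_ , eq) = trans (toℕ-position u) (m<n⇒m/n≡0 (m∸n≡0⇒m≤n eq))

  next-to-centre⁻ : ∀ {u} → toℕ (position u) ≡ 0 → suc u ↗ zero
  next-to-centre⁻ {u} eq = (λ ()) , m≤n⇒m∸n≡0 (≰⇒> λ r≤u →
    contradiction (trans (sym (m/n≡1+[m∸n]/n r≤u)) (trans (sym (toℕ-position u)) eq)) λ ())

  numbered≅spider : graph ≅ spider ℓ
  numbered≅spider = record
    { bijection = mk⤖ (place-injective , place-surjective)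
    ; adjacency = adjacent
    }
    where
    adjacent : ∀ u v → Graph._~_ graph u v ⇔ Graph._~_ (spider ℓ) (place u) (place v)
    adjacent zero    zero    = mk⇔ [ (λ p → proj₁ p refl) , (λ p → proj₁ p refl) ]′ λ ()
    adjacent zero    (suc v) = mk⇔ [ (λ p → contradiction refl (proj₁ p)) , next-to-centre ]′
      (inj₂ ∘ next-to-centre⁻)
    adjacent (suc u) zero    = mk⇔ [ next-to-centre , (λ p → contradiction refl (proj₁ p)) ]′
      (inj₁ ∘ next-to-centre⁻)
    adjacent (suc u) (suc v) = mk⇔
      [ (λ p → let l , s = same-leg u v p in l , inj₂ s)
      , (λ p → let l , s = same-leg v u p in sym l , inj₁ s) ]′
      λ { (l , inj₁ s) → inj₂ (same-leg⁻ v u (sym l) s) ; (l , inj₂ s) → inj₁ (same-leg⁻ u v l s) }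

numbered≅S : ∀ m r .{{_ : NonZero r}} → 3 ≤ r → Numbered.graph m r ≅ proj₂ (S (suc m) r)
numbered≅S m 1 (s≤s ())
numbered≅S m 2 (s≤s (s≤s ()))
-- The Boolean test in `S` is generalised so that it can be matched on; a true test says `r = suc m`
-- or `r = m`, and either gives `m ≤ r`.
numbered≅S m r@(suc (suc (suc _))) _ = go (does ((r ≟ suc m) ⊎-dec (r ≟ m))) λ b≡true →
  [ (λ { refl → n≤1+n m }) , (λ { refl → ≤-refl }) ]′ (does-true ((r ≟ suc m) ⊎-dec (r ≟ m)) b≡true)
  where
  does-true : {P : Set} (P? : Dec P) → does P? ≡ true → P
  does-true (yes p) _ = p

  go : ∀ b → (b ≡ true → m ≤ r) →
    Numbered.graph m r ≅ proj₂ (if_then_else_ {A = Σ Set Graph} b (_ , star (suc m))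
      (_ , spider (balanced (suc m) r)))
  go true  m≤r = NumberedShapes.numbered≅star m r (m≤r refl)
  go false _   = NumberedShapes.numbered≅spider m r

-- Two odd vertices: paths.

-- With at most one leaf, every level has at most one vertex, so `depth` is itself the numbering
-- along the path.
path-case : ∀ {n} {G : Graph (Fin n)} → G ∈𝒪 1 → G ≅ path n
path-case {n} {G} (tree , #odd≡2) = record
  { bijection = injective⇒⤖ {f = φ}
    (λ eq → depth-injective (trans (sym (toℕ-fromℕ< _)) (trans (cong toℕ eq) (toℕ-fromℕ< _))))
  ; adjacency = λ u v → mk⇔
      (swap ∘ Sum.map to to ∘ edge-parent)
      ([ ↑⇒~ ∘ from , ~-sym ∘ ↑⇒~ ∘ from ]′ ∘ swap)
  }
  where
  odd-vertex : ∃ (OddVertex G)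
  odd-vertex = count-witness (oddVertex? G) (≤-trans (s≤s z≤n) (≤-reflexive (sym #odd≡2)))

  R : Rooting G
  R = TreeRooting.rooting tree (proj₁ odd-vertex)

  open Graph G
  open Rooting R
  open Rooted R
  open Levels R

  -- The root is odd but not counted as a leaf.
  #leaf≤1 : #leaf ≤ 1
  #leaf≤1 = s≤s⁻¹ (≤-trans
    (count-strict leaf? (oddVertex? G) leaf⇒odd root (proj₂ odd-vertex) (λ leaf → proj₁ leaf refl))
    (≤-reflexive #odd≡2))

  depth-injective : Injective _≡_ _≡_ depth
  depth-injective {u} {v} eq = go (depth v) eq refl
    where
    go : ∀ d → depth u ≡ d → depth v ≡ d → u ≡ v
    go zero    du dv = trans (depth≡0⇒root du) (sym (depth≡0⇒root dv))
    go (suc d) du dv = count-unique (λ w → depth w ≟ suc d) (≤-trans (level≤#leaf d) #leaf≤1) du dv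

  φ : Fin n → Fin n
  φ v = fromℕ< (depth<n v)

  to : ∀ {u v} → u ↑ v → suc (toℕ (φ v)) ≡ toℕ (φ u)
  to {u} {v} p = trans (cong suc (toℕ-fromℕ< (depth<n v)))
    (trans (sym (↑⇒depth p)) (sym (toℕ-fromℕ< (depth<n u))))

  from : ∀ {u v} → suc (toℕ (φ v)) ≡ toℕ (φ u) → u ↑ v
  from {u} {v} eq = suc-depth⇒nonroot du , depth-injective (parent-depth du)
    where
    du : depth u ≡ suc (depth v)
    du = sym (trans (cong suc (sym (toℕ-fromℕ< (depth<n v)))) (trans eq (toℕ-fromℕ< (depth<n u))))

-- Maximal trees attain all the bounds.

module Maximal {m r : ℕ} .{{_ : NonZero r}} (1≤m : 1 ≤ m) (r≤1+m : r ≤ suc m) (r-even : r % 2 ≡ 0)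
  {T : Graph (Fin (suc m))} (tree : IsTree T) (#odd≡r : #odd T ≡ r)
  (Mo-max : Mo (Numbered.graph m r) ≤ Mo T) where

  c : Fin (suc m)
  c = proj₁ (median T)

  R : Rooting T
  R = TreeRooting.rooting tree c

  module N = Numbered m r

  open Rooted R
  open Levels R

  #leaf≤r : #leaf ≤ r
  #leaf≤r = ≤-trans (count-mono leaf? (oddVertex? T) leaf⇒odd) (≤-reflexive #odd≡r)

  -- The upper bound holds for T at its median and the lower bound for the model. Both trees have
  -- `m` non-root vertices, so the two bounds have the same product `m * suc m`, and maximality
  -- compares the indices.
  total-depth≤ : total-depth ≤ Rooted.total-depth N.rooting
  total-depth≤ = *-cancelˡ-≤ 2 (+-cancelˡ-≤ (Mo T) _ _ (begin
    Mo T + 2 * total-depth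
      ≤⟨ Median.Mo-median tree c (proj₂ (median T)) ⟩
    #nonroot * suc m
      ≡⟨ cong (_* suc m) (suc-injective (trans suc-#nonroot (sym (Rooted.suc-#nonroot N.rooting)))) ⟩
    Rooted.#nonroot N.rooting * suc m                     ≤⟨ Rooted.Mo-lower N.rooting ⟩
    Mo N.graph + 2 * Rooted.total-depth N.rooting         ≤⟨ +-monoˡ-≤ _ Mo-max ⟩
    Mo T + 2 * Rooted.total-depth N.rooting               ∎))
    where open ≤-Reasoning

  ∑-deep≤ : ∑ {suc m} (λ i → deep (suc (toℕ i))) ≤ ∑ {suc m} (λ i → m ∸ r * toℕ i)
  ∑-deep≤ = begin
    ∑ {suc m} (λ i → deep (suc (toℕ i)))                           ≡⟨ total-depth≡∑-deep ⟨
    total-depth                                                    ≤⟨ total-depth≤ ⟩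
    Rooted.total-depth N.rooting
      ≡⟨ Levels.total-depth≡∑-deep N.rooting ⟩
    ∑ {suc m} (λ i → Levels.deep N.rooting (suc (toℕ i)))
      ≡⟨ ∑-cong {suc m} (λ i → N.deep≡ (toℕ i)) ⟩
    ∑ {suc m} (λ i → m ∸ r * toℕ i)                                ∎
    where open ≤-Reasoning

  deep-lower′ : ∀ i → m ∸ r * i ≤ deep (suc i)
  deep-lower′ i = ≤-trans (≤-reflexive (cong (_∸ r * i) (sym (suc-injective suc-#nonroot))))
    (deep-lower #leaf≤r i)

  -- The terms are bounded from below one by one and from above in total, so `∑-squeeze` applies;
  -- `i < suc m` is the range of the sum.
  deep≡ : ∀ i → i < suc m → deep (suc i) ≡ m ∸ r * i
  deep≡ i i<n = subst (λ i → deep (suc i) ≡ m ∸ r * i) (toℕ-fromℕ< i<n)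
    (sym (∑-squeeze {suc m} (λ i → deep-lower′ (toℕ i)) ∑-deep≤ (fromℕ< i<n)))

  ≅-numbered : T ≅ N.graph
  ≅-numbered = Tight.≅-numbered R r 1≤m #leaf≤r deep≡

theorem3p1 : (n k : ℕ) → 1 ≤ k → k ≤ n / 2 →
    (T : Graph (Fin n)) → T ∈𝒪 k →
    (∀ (T′ : Graph (Fin n)) → T′ ∈𝒪 k → Mo T′ ≤ Mo T) →
    T ≅ proj₂ (S n (2 * k))
theorem3p1 n 1 _ _ T T∈𝒪 _ = path-case T∈𝒪
theorem3p1 zero (suc (suc _)) _ ()
theorem3p1 (suc m) k@(suc (suc k-2)) _ k≤n/2 T (tree , #odd≡2k) Mo-max =
  ≅-trans
    (Maximal.≅-numbered (s≤s⁻¹ (≤-trans (s≤s (s≤s z≤n)) (≤-trans 3≤2k 2k≤n))) 2k≤n (2*k%2≡0 k) tree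
      #odd≡2k
      -- The model itself belongs to the class, so the maximality of T applies to it.
      (Mo-max N.graph (N.isTree , N.#odd≡r 2k≤n (2*k%2≡0 k))))
    (numbered≅S m (2 * k) 3≤2k)
  where
  module N = Numbered m (2 * k)
  2k≤n : 2 * k ≤ suc m
  2k≤n = ≤-trans (*-monoʳ-≤ 2 k≤n/2) (≤-trans (≤-reflexive (*-comm 2 (suc m / 2))) (m/n*n≤m (suc m) 2))
  3≤2k : 3 ≤ 2 * k
  3≤2k = ≤-trans (s≤s (s≤s (s≤s z≤n))) (*-monoʳ-≤ 2 {2} {k} (s≤s (s≤s z≤n)))
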